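{- Let $\mathbf A$ be a finite nilpotent Malcev algebra. Then $\mathrm{nuP}_{\mathbf A}\subseteq\mathsf{CC}^0$.
   Context: $\mathsf{CC}^0$ is the class of languages recognized by polynomial-size constant-depth circuit families built of unbounded fan-in $\mathrm{MOD}_m$ gates (for a fixed $m$), where a $\mathrm{MOD}_m$ gate with accepting set $T\subseteq\mathbb Z_m$ outputs 1 iff the sum of its Boolean inputs modulo $m$ lies in $T$. For a finite algebra $\mathbf A$, $\mathrm{nuP}_{\mathbf A}$ is the class of languages over $\{0,1\}$ recognized by NuDFAs $((t_n),\iota,S)$ with $t_n$ $n$-input circuits over $\mathbf A$ (sources variables or constants of $A$, gates basic operations) of size polynomial in $n$, $\iota:\{0,1\}\to A$, $S\subseteq A$, accepting $b$ iff $t_n(\iota(b_1),\dots,\iota(b_n))\in S$. Malcev: has a term $d$ with $d(x,y,y)=d(y,y,x)=x$; nilpotent in the commutator-theory sense. -}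

module Defs where

open import Data.Nat using (ℕ; zero; suc; _+_; _*_; _^_; _≤_; _⊔_)
open import Data.Nat.DivMod using (_mod_)
open import Data.Fin using (Fin; zero; suc)
open import Data.Bool using (Bool; true; false; _∧_; if_then_else_)
open import Data.Product using (Σ; _×_; _,_; proj₁; proj₂)
open import Data.Unit using (⊤)
open import Data.Vec.Functional using (_++_)
open import Function using (_∘_)
open import Relation.Binary.PropositionalEquality using (_≡_)

record FinAlgebra : Set where
  field
    size  : ℕ
    nOps  : ℕ
    arity : Fin nOps → ℕ
    op    : (f : Fin nOps) → (Fin (arity f) → Fin size) → Fin size

module _ (𝔸 : FinAlgebra) where
  open FinAlgebra 𝔸

  Carrier : Set
  Carrier = Fin size

  data Term (n : ℕ) : Set where
    var : Fin n → Term n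
    app : (f : Fin nOps) → (Fin (arity f) → Term n) → Term n

  ⟦_⟧ : ∀ {n} → Term n → (Fin n → Carrier) → Carrier
  ⟦ var i ⟧ ρ = ρ i
  ⟦ app f ts ⟧ ρ = op f (λ i → ⟦ ts i ⟧ ρ)

  env3 : Carrier → Carrier → Carrier → Fin 3 → Carrier
  env3 x y z zero = x
  env3 x y z (suc zero) = y
  env3 x y z (suc (suc zero)) = z

  IsMalcev : Set
  IsMalcev = Σ (Term 3) λ d → ∀ x y →
    (⟦ d ⟧ (env3 x y y) ≡ x) × (⟦ d ⟧ (env3 y y x) ≡ x)

  BRel : Set
  BRel = Carrier → Carrier → Bool

  record IsCong (γ : BRel) : Set where
    field
      refl   : ∀ x → γ x x ≡ true
      sym    : ∀ x y → γ x y ≡ true → γ y x ≡ true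
      trans  : ∀ x y z → γ x y ≡ true → γ y z ≡ true → γ x z ≡ true
      compat : ∀ f (a b : Fin (arity f) → Carrier) →
               (∀ i → γ (a i) (b i) ≡ true) → γ (op f a) (op f b) ≡ true

  Rel' : Set₁
  Rel' = Carrier → Carrier → Set

  Centralizes : Rel' → Rel' → BRel → Set
  Centralizes α β γ = ∀ m n (t : Term (m + n)) (a a' : Fin m → Carrier)
    (b b' : Fin n → Carrier) →
    (∀ i → α (a i) (a' i)) → (∀ j → β (b j) (b' j)) →
    γ (⟦ t ⟧ (a ++ b)) (⟦ t ⟧ (a ++ b')) ≡ true →
    γ (⟦ t ⟧ (a' ++ b)) (⟦ t ⟧ (a' ++ b')) ≡ true

  Commutator : Rel' → Rel' → Rel'
  Commutator α β x y = ∀ (γ : BRel) → IsCong γ → Centralizes α β γ → γ x y ≡ true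

  total : Rel'
  total _ _ = ⊤

  lowerCentral : ℕ → Rel'
  lowerCentral zero = total
  lowerCentral (suc i) = Commutator total (lowerCentral i)

  IsNilpotent : Set
  IsNilpotent = Σ ℕ λ i → ∀ x y → lowerCentral i x y → x ≡ y

  -- Circuits over 𝔸 as straight-line programs; node zero is the newest
  -- (output) node, a gate may only refer to older nodes.

  data AGate (n s : ℕ) : Set where
    input : Fin n → AGate n s
    const : Carrier → AGate n s
    gate  : (f : Fin nOps) → (Fin (arity f) → Fin s) → AGate n s

  data ACirc (n : ℕ) : ℕ → Set where
    []  : ACirc n 0
    _∷_ : ∀ {s} → AGate n s → ACirc n s → ACirc n (suc s)

  agateVal : ∀ {n s} → AGate n s → (Fin n → Carrier) → (Fin s → Carrier) → Carrier
  agateVal (input i) ρ v = ρ i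
  agateVal (const c) ρ v = c
  agateVal (gate f ins) ρ v = op f (v ∘ ins)

  aVals : ∀ {n s} → ACirc n s → (Fin n → Carrier) → Fin s → Carrier
  aVals (g ∷ c) ρ zero = agateVal g ρ (aVals c ρ)
  aVals (g ∷ c) ρ (suc i) = aVals c ρ i

  aOut : ∀ {n s} → ACirc n (suc s) → (Fin n → Carrier) → Carrier
  aOut c ρ = aVals c ρ zero

Lang : Set
Lang = (n : ℕ) → (Fin n → Bool) → Bool

PolyBounded : ℕ → (ℕ → ℕ) → Set
PolyBounded c sz = ∀ n → sz n ≤ c * n ^ c + c

-- nuP_𝔸: languages recognized by polynomial-size NuDFAs ((t_n), ι, S);
-- the size of t_n = number of nodes (sources and gates)
nuP : FinAlgebra → Lang → Set
nuP 𝔸 L =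
  Σ ℕ λ c →
  Σ ((n : ℕ) → Σ ℕ λ s → ACirc 𝔸 n (suc s)) λ t →
  Σ (Bool → Carrier 𝔸) λ ι →
  Σ (Carrier 𝔸 → Bool) λ S →
    PolyBounded c (λ n → suc (proj₁ (t n))) ×
    (∀ n (w : Fin n → Bool) → S (aOut 𝔸 (proj₂ (t n)) (ι ∘ w)) ≡ L n w)

sumF : (s : ℕ) → (Fin s → ℕ) → ℕ
sumF zero f = 0
sumF (suc s) f = f zero + sumF s (f ∘ suc)

maxF : (s : ℕ) → (Fin s → ℕ) → ℕ
maxF zero f = 0
maxF (suc s) f = f zero ⊔ maxF s (f ∘ suc)

-- accepting test of a MOD_m gate: (count mod m) ∈ T   (m = 0 never used)
modAccept : (m : ℕ) → (Fin m → Bool) → ℕ → Bool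
modAccept zero T k = false
modAccept (suc m) T k = T (k mod suc m)

data MGate (m n s : ℕ) : Set where
  input : Fin n → MGate m n s
  modg  : (T : Fin m → Bool) → (ins : Fin s → Bool) → MGate m n s

data MCirc (m n : ℕ) : ℕ → Set where
  []  : MCirc m n 0
  _∷_ : ∀ {s} → MGate m n s → MCirc m n s → MCirc m n (suc s)

mgateVal : ∀ {m n s} → MGate m n s → (Fin n → Bool) → (Fin s → Bool) → Bool
mgateVal (input i) w v = w i
mgateVal {m} {s = s} (modg T ins) w v =
  modAccept m T (sumF s (λ j → if ins j ∧ v j then 1 else 0))

mVals : ∀ {m n s} → MCirc m n s → (Fin n → Bool) → Fin s → Bool
mVals (g ∷ c) w zero = mgateVal g w (mVals c w)
mVals (g ∷ c) w (suc i) = mVals c w i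

mgateDepth : ∀ {m n s} → MGate m n s → (Fin s → ℕ) → ℕ
mgateDepth (input i) d = 0
mgateDepth {s = s} (modg T ins) d = suc (maxF s (λ j → if ins j then d j else 0))

mDepths : ∀ {m n s} → MCirc m n s → Fin s → ℕ
mDepths (g ∷ c) zero = mgateDepth g (mDepths c)
mDepths (g ∷ c) (suc i) = mDepths c i

mOut : ∀ {m n s} → MCirc m n (suc s) → (Fin n → Bool) → Bool
mOut c w = mVals c w zero

mDepth : ∀ {m n s} → MCirc m n (suc s) → ℕ
mDepth c = mDepths c zero

CC0 : Lang → Set
CC0 L =
  Σ ℕ λ m → 2 ≤ m ×
  Σ ℕ λ d → Σ ℕ λ c →
  Σ ((n : ℕ) → Σ ℕ λ s → MCirc m n (suc s)) λ C →
    PolyBounded c (λ n → suc (proj₁ (C n))) ×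
    (∀ n → mDepth (proj₂ (C n)) ≤ d) ×
    (∀ n (w : Fin n → Bool) → mOut (proj₂ (C n)) w ≡ L n w)

{-# OPTIONS --safe #-}
-- If α is central modulo γ, then modulo γ every element a is determined by its
-- α-class and a coordinate ℓ(a) in an abelian group living on one α-class, and
-- each basic operation acts on coordinates as a group homomorphism plus a term
-- depending on the α-classes of the arguments only.  Hence, however deep the
-- circuit, the coordinate of each node is a sum over all nodes w of fixed
-- functions of the classes at the inputs of w; grouping the summands by value,
-- the sum is determined by counts modulo the exponent of the group.  So one step
-- down the central series costs a constant number of MOD layers, and nilpotency
-- bounds the number of steps.
module Submission where

open import Defs
open import Algebra.Bundles using (AbelianGroup)
import Algebra.Properties.CommutativeMonoid.Sum as Sum
import Algebra.Properties.Group as GroupProperties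
import Algebra.Properties.Monoid.Mult as Mult
open import Algebra.Structures using (IsAbelianGroup)
open import Data.Bool using (Bool; true; false; _∧_; if_then_else_)
import Data.Bool.Properties as Bool
open import Data.Fin
  using (Fin; zero; suc; toℕ; _↑ˡ_; _↑ʳ_; combine; remQuot; finToFun; funToFin; splitAt; join)
open import Data.Fin.Patterns using (0F; 1F; 2F)
open import Data.Fin.Properties
  using (_≟_; all?; toℕ<n; toℕ-injective; toℕ-fromℕ<; toℕ-combine; remQuot-combine;
         finToFun-funToFin; join-splitAt; pigeonhole; nonZeroIndex)
open import Data.List using (List; []; _∷_; foldr; allFin)
open import Data.List.Membership.Propositional using (_∈_)
open import Data.List.Membership.Propositional.Properties using (∈-allFin)
open import Data.List.Relation.Unary.Any using (here; there)
open import Data.Nat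
  using (ℕ; zero; suc; _+_; _*_; _^_; _∸_; _≤_; _<_; _<ᵇ_; _≡ᵇ_; _!; z≤n; s≤s; NonZero; pred)
open import Data.Nat.Divisibility
  using (_∣_; divides; ∣-trans; ∣-reflexive; m≤n⇒m!∣n!; m∣m*n; n∣m*n)
open import Data.Nat.DivMod
  using (_%_; _/_; _mod_; m%n<n; m%n%n≡m%n; m<n⇒m%n≡m; %-distribˡ-+; m∣n⇒o%n%m≡o%m;
         m≡m%n+[m/n]*n)
open import Data.Nat.Properties hiding (_≟_)
open import Data.Nat.Tactic.RingSolver using (solve-∀)
open import Data.Product using (Σ; _×_; _,_; proj₁; proj₂)
open import Data.Sum using (_⊎_; inj₁; inj₂)
open import Data.Unit using (tt)
import Data.Vec.Functional as Vector
open import Data.Vec.Functional.Properties using (lookup-++ˡ; lookup-++ʳ)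
open import Function using (_∘_; id)
open import Relation.Binary.PropositionalEquality
  using (_≡_; _≗_; refl; sym; trans; cong; cong₂; subst; subst₂; module ≡-Reasoning)
open import Relation.Nullary using (Dec; yes; does)
open import Relation.Nullary.Decidable using (map′; _×-dec_; _→-dec_; dec-true)

-- The fixed functions in the sum depend on the given circuit alone, so nonuniformity makes them
-- free: the MOD circuit never follows paths, and it treats all nodes at once. Between two counting
-- layers, functions of boundedly many signals must be evaluated, and there are no AND gates. The
-- modulus pays for this: it is chosen after the algebra, so large that a bounded tuple of signals
-- can be packed into one number below it, which a single gate decodes. A second obstacle is
-- constructive. Choosing class representatives requires Boolean-valued congruences, whereas the
-- lower central series is `Set`-valued. The descent therefore follows a chain `level` of Boolean
-- congruences contained in that series.

∀fun? : ∀ {k n} {P : (Fin k → Fin n) → Set} →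
        (∀ {f g} → f ≗ g → P f → P g) → (∀ f → Dec (P f)) → Dec (∀ f → P f)
∀fun? resp P? = map′
  (λ p f → resp (finToFun-funToFin f) (p (funToFin f))) (λ p i → p (finToFun i))
  (all? (P? ∘ finToFun))

dec-witness : {P : Set} (P? : Dec P) → does P? ≡ true → P
dec-witness (yes p) _ = p

OpExt : FinAlgebra → Set
OpExt 𝔸 = ∀ f {a b : Fin (arity f) → Fin size} → a ≗ b → op f a ≡ op f b
  where open FinAlgebra 𝔸

-- With function extensionality unavailable, nilpotency is what makes the
-- basic operations respect pointwise equality: all congruences identify the
-- two values.
nilpotent⇒opExt : ∀ 𝔸 → IsNilpotent 𝔸 → OpExt 𝔸
nilpotent⇒opExt 𝔸 (i , lc⇒≡) f {a} {b} a≗b = lc⇒≡ _ _ (central i)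
  where
  open FinAlgebra 𝔸
  central : ∀ i → lowerCentral 𝔸 i (op f a) (op f b)
  central zero = tt
  central (suc i) γ γ-cong _ = compat f a b
    (λ j → subst (λ x → γ (a j) x ≡ true) (a≗b j) (IsCong.refl γ-cong (a j)))
    where open IsCong γ-cong

-- Centrality in Malcev algebras and its equational consequences

module Malcev
  (𝔸 : FinAlgebra) (op-ext : OpExt 𝔸) (malcev : IsMalcev 𝔸)
  (𝟎 : Carrier 𝔸) where

  open FinAlgebra 𝔸

  A : Set
  A = Carrier 𝔸

  _≡[_]_ : A → BRel 𝔸 → A → Set
  x ≡[ γ ] y = γ x y ≡ true

  eval : ∀ {n} → Term 𝔸 n → (Fin n → A) → A
  eval = ⟦_⟧ 𝔸

  eval-ext : ∀ {n} (t : Term 𝔸 n) {ρ σ} → ρ ≗ σ → eval t ρ ≡ eval t σ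
  eval-ext (var i) ρ≗σ = ρ≗σ i
  eval-ext (app f ts) ρ≗σ = op-ext f (λ i → eval-ext (ts i) ρ≗σ)

  eval-cong : ∀ {γ} → IsCong 𝔸 γ → ∀ {n} (t : Term 𝔸 n) {ρ σ} →
              (∀ i → ρ i ≡[ γ ] σ i) → eval t ρ ≡[ γ ] eval t σ
  eval-cong c (var i) ργσ = ργσ i
  eval-cong c (app f ts) ργσ = IsCong.compat c f _ _ (λ i → eval-cong c (ts i) ργσ)

  _[_] : ∀ {n k} → Term 𝔸 n → (Fin n → Term 𝔸 k) → Term 𝔸 k
  var i [ σ ] = σ i
  app f ts [ σ ] = app f (λ i → ts i [ σ ])

  eval-[] : ∀ {n k} (t : Term 𝔸 n) (σ : Fin n → Term 𝔸 k) ρ →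
            eval (t [ σ ]) ρ ≡ eval t (λ i → eval (σ i) ρ)
  eval-[] (var i) σ ρ = refl
  eval-[] (app f ts) σ ρ = op-ext f (λ i → eval-[] (ts i) σ ρ)

  d : A → A → A → A
  d x y z = eval (proj₁ malcev) (env3 𝔸 x y z)

  d-xyy : ∀ {x y} → d x y y ≡ x
  d-xyy = proj₁ (proj₂ malcev _ _)

  d-yyx : ∀ {x y} → d y y x ≡ x
  d-yyx = proj₂ (proj₂ malcev _ _)

  d-cong : ∀ {γ} → IsCong 𝔸 γ → ∀ {x x' y y' z z'} →
           x ≡[ γ ] x' → y ≡[ γ ] y' → z ≡[ γ ] z' → d x y z ≡[ γ ] d x' y' z'
  d-cong c p q r = eval-cong c (proj₁ malcev) λ { 0F → p ; 1F → q ; 2F → r }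

  d-cong≡ : ∀ {x x' y y' z z'} → x ≡ x' → y ≡ y' → z ≡ z' → d x y z ≡ d x' y' z'
  d-cong≡ refl refl refl = refl

  data Poly (m n : ℕ) : Set where
    cst : A → Poly m n
    X   : Fin m → Poly m n
    Y   : Fin n → Poly m n
    D   : Poly m n → Poly m n → Poly m n → Poly m n
    F   : (f : Fin nOps) → (Fin (arity f) → Poly m n) → Poly m n

  ev : ∀ {m n} → Poly m n → (Fin m → A) → (Fin n → A) → A
  ev (cst a) x y = a
  ev (X i) x y = x i
  ev (Y j) x y = y j
  ev (D p q r) x y = d (ev p x y) (ev q x y) (ev r x y)
  ev (F f ps) x y = op f (λ i → ev (ps i) x y)

  private
    triple : ∀ {n} → Term 𝔸 n → Term 𝔸 n → Term 𝔸 n → Fin 3 → Term 𝔸 n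
    triple p q r 0F = p
    triple p q r 1F = q
    triple p q r 2F = r

  -- Terms have no constants, so each element of the algebra gets a variable of its own, evaluated
  -- by `id`. These variables join the block `x`, which centrality lets vary freely.
  term : ∀ {m n} → Poly m n → Term 𝔸 ((size + m) + n)
  term {m} {n} (cst a) = var ((a ↑ˡ m) ↑ˡ n)
  term {m} {n} (X i) = var ((size ↑ʳ i) ↑ˡ n)
  term {m} {n} (Y j) = var ((size + m) ↑ʳ j)
  term (D p q r) = proj₁ malcev [ triple (term p) (term q) (term r) ]
  term (F f ps) = app f (term ∘ ps)

  eval-term : ∀ {m n} (p : Poly m n) x y →
              eval (term p) ((id Vector.++ x) Vector.++ y) ≡ ev p x y
  eval-term {m} {n} (cst a) x y =
    trans (lookup-++ˡ (id Vector.++ x) y (a ↑ˡ m)) (lookup-++ˡ id x a)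
  eval-term (X i) x y =
    trans (lookup-++ˡ (id Vector.++ x) y (size ↑ʳ i)) (lookup-++ʳ id x i)
  eval-term (Y j) x y = lookup-++ʳ (id Vector.++ x) y j
  eval-term (D p q r) x y = trans
    (eval-[] (proj₁ malcev) _ _)
    (eval-ext (proj₁ malcev) λ
      { 0F → eval-term p x y ; 1F → eval-term q x y ; 2F → eval-term r x y })
  eval-term (F f ps) x y = op-ext f (λ i → eval-term (ps i) x y)

  -- A retraction onto the class of `𝟎`. It lets the group on that class be presented on the whole
  -- carrier, without a subtype.
  clamp : BRel 𝔸 → A → A
  clamp α x = if α x 𝟎 then x else 𝟎

  rep : BRel 𝔸 → A → A
  rep α a = foldr (λ b r → if α a b then b else r) 𝟎 (allFin size)

  module _ {α : BRel 𝔸} (α-cong : IsCong 𝔸 α) where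
    private module α = IsCong α-cong

    clamp-𝟎 : ∀ x → clamp α x ≡[ α ] 𝟎
    clamp-𝟎 x with α x 𝟎 in eq
    ... | true = eq
    ... | false = α.refl 𝟎

    rep-related : ∀ a → a ≡[ α ] rep α a
    rep-related a = go (allFin size) (∈-allFin a)
      where
      go : ∀ bs → a ∈ bs → a ≡[ α ] foldr (λ b r → if α a b then b else r) 𝟎 bs
      go (b ∷ bs) a∈ with α a b in eq
      go (b ∷ bs) a∈ | true = eq
      go (b ∷ bs) (there a∈) | false = go bs a∈
      go (b ∷ bs) (here refl) | false with () ← trans (sym eq) (α.refl a)

    rep-unique : ∀ {a b} → a ≡[ α ] b → rep α a ≡ rep α b
    rep-unique {a} {b} ab = go (allFin size)
      where
      same : ∀ c → α a c ≡ α b c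
      same c with α a c in eq₁ | α b c in eq₂
      ... | true | true = refl
      ... | false | false = refl
      ... | true | false = trans (sym (α.trans b a c (α.sym a b ab) eq₁)) eq₂
      ... | false | true = trans (sym eq₁) (α.trans a b c ab eq₂)
      go : ∀ bs → foldr (λ c r → if α a c then c else r) 𝟎 bs ≡
                  foldr (λ c r → if α b c then c else r) 𝟎 bs
      go [] = refl
      go (c ∷ bs) rewrite same c = cong (λ r → if α b c then c else r) (go bs)

  clamp-id : ∀ {α x} → x ≡[ α ] 𝟎 → clamp α x ≡ x
  clamp-id eq rewrite eq = refl

  lin : ∀ f → (Fin (arity f) → A) → A
  lin f x = d (op f x) (op f (λ _ → 𝟎)) 𝟎

  -- The equations, modulo γ, through which centrality of α modulo γ is used.
  -- Clamped variables range over the α-class of 𝟎.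
  data Law : Set where
    comm  : A → A → Law
    assoc : A → A → A → Law
    inv   : A → Law
    recon : A → Law
    add   : ∀ f → (x y : Fin (arity f) → A) → Law
    split : ∀ f → (l r : Fin (arity f) → A) → A → Law

  module _ (α : BRel 𝔸) where
    private
      c : A → A
      c = clamp α

    -- With `x + y = d x 𝟎 y`, the first three laws say that the class of `𝟎` is an abelian group
    -- with inverse `d 𝟎 x 𝟎`. By `recon`, `a` is the sum of its coordinate `d a (rep α a) 𝟎` and
    -- its representative; by `add`, `lin f` is additive. In `split`, `s` will be the representative
    -- of the value, so that the law reads off the coordinate of `f` at `l + r`.
    lhs rhs : Law → A
    lhs (comm x y) = d (c x) 𝟎 (c y)
    lhs (assoc x y z) = d (d (c x) 𝟎 (c y)) 𝟎 (c z)
    lhs (inv x) = d (d 𝟎 (c x) 𝟎) 𝟎 (c x)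
    lhs (recon a) = d (d a (rep α a) 𝟎) 𝟎 (rep α a)
    lhs (add f x y) = lin f (λ i → d (c (x i)) 𝟎 (c (y i)))
    lhs (split f l r s) = d (op f (λ i → d (c (l i)) 𝟎 (r i))) s 𝟎
    rhs (comm x y) = d (c y) 𝟎 (c x)
    rhs (assoc x y z) = d (c x) 𝟎 (d (c y) 𝟎 (c z))
    rhs (inv x) = 𝟎
    rhs (recon a) = a
    rhs (add f x y) = d (lin f (c ∘ x)) 𝟎 (lin f (c ∘ y))
    rhs (split f l r s) = d (lin f (c ∘ l)) 𝟎 (d (op f r) s 𝟎)

  lin-ext : ∀ f {x y} → x ≗ y → lin f x ≡ lin f y
  lin-ext f x≗y = d-cong≡ (op-ext f x≗y) refl refl

  module Rectangle
    {α γ : BRel 𝔸} (α-cong : IsCong 𝔸 α) (γ-cong : IsCong 𝔸 γ)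
    (central : Centralizes 𝔸 (total 𝔸) (λ x y → x ≡[ α ] y) γ) where

    private
      module α = IsCong α-cong
      module γ = IsCong γ-cong

    termCondition : ∀ {m n} (p : Poly m n) {x x' y y'} →
                    (∀ j → y j ≡[ α ] y' j) →
                    ev p x y ≡[ γ ] ev p x y' → ev p x' y ≡[ γ ] ev p x' y'
    termCondition {m} {n} p {x} {x'} {y} {y'} yαy' e =
      subst₂ (λ a b → γ a b ≡ true) (eval-term p x' y) (eval-term p x' y')
        (central (size + m) n (term p) (id Vector.++ x) (id Vector.++ x') y y'
          (λ _ → tt) yαy'
          (subst₂ (λ a b → γ a b ≡ true)
            (sym (eval-term p x y)) (sym (eval-term p x y')) e))

    ev-cong : ∀ {m n} (p : Poly m n) {x y y'} →
              (∀ j → y j ≡[ α ] y' j) → ev p x y ≡[ α ] ev p x y'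
    ev-cong (cst a) yαy' = α.refl a
    ev-cong (X i) yαy' = α.refl _
    ev-cong (Y j) yαy' = yαy' j
    ev-cong (D p q r) yαy' =
      d-cong α-cong (ev-cong p yαy') (ev-cong q yαy') (ev-cong r yαy')
    ev-cong (F f ps) yαy' = α.compat f _ _ (λ i → ev-cong (ps i) yαy')

    γ-refl : ∀ {x y} → x ≡ y → x ≡[ γ ] y
    γ-refl refl = γ.refl _

    -- The term d(p, q, 𝟎) takes the value 𝟎 at the three corners, so by
    -- centrality it does so at the fourth one, and d(p, q, 𝟎) = d(q, q, 𝟎)
    -- can be cancelled, again by centrality.
    rectangle : ∀ {m n} (p q : Poly m n) {x x' y y'} → (∀ j → y j ≡[ α ] y' j) →
                ev p x y ≡ ev q x y → ev p x y' ≡ ev q x y' → ev p x' y ≡ ev q x' y →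
                ev p x' y' ≡[ γ ] ev q x' y'
    rectangle p q {x} {x'} {y} {y'} yαy' e₁ e₂ e₃ = cancel
      where
      zero-at : ∀ {x y} → ev p x y ≡ ev q x y → ev (D p q (cst 𝟎)) x y ≡ 𝟎
      zero-at e = trans (d-cong≡ e refl refl) d-yyx

      dPQ : 𝟎 ≡[ γ ] d (ev p x' y') (ev q x' y') 𝟎
      dPQ = subst (λ a → γ a _ ≡ true) (zero-at e₃)
        (termCondition (D p q (cst 𝟎)) yαy'
          (γ-refl (trans (zero-at e₁) (sym (zero-at e₂)))))

      QαP : ev q x' y' ≡[ α ] ev p x' y'
      QαP = α.trans _ _ _ (α.sym _ _ (ev-cong q yαy'))
        (subst (λ a → α a _ ≡ true) e₃ (ev-cong p yαy'))

      cancel : ev p x' y' ≡[ γ ] ev q x' y'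
      cancel = γ.sym _ _ (subst₂ (λ a b → γ a b ≡ true) d-xyy d-xyy
        (termCondition {2} {1} (D (Y 0F) (X 0F) (X 1F))
          {ev q x' y' Vector.∷ 𝟎 Vector.∷ Vector.[]}
          {ev q x' y' Vector.∷ ev q x' y' Vector.∷ Vector.[]}
          {λ _ → ev q x' y'} {λ _ → ev p x' y'}
          (λ _ → QαP)
          (subst (λ a → γ a (d (ev p x' y') (ev q x' y') 𝟎) ≡ true) (sym d-yyx) dPQ)))

    private
      c : A → A
      c = clamp α

      𝟎αc : ∀ x → 𝟎 ≡[ α ] c x
      𝟎αc x = α.sym _ _ (clamp-𝟎 α-cong x)

      -- Both occurrences of `𝟎` become one variable. With `r` in its place the equation is a Malcev
      -- identity, and for `a = r` it is one whatever the variable; these are the three known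
      -- corners.
      reconstruct : ∀ {a r} → r ≡[ α ] a → d (d a r 𝟎) 𝟎 r ≡[ γ ] a
      reconstruct {a} {r} rαa = rectangle {2} {1}
        (D (D (Y 0F) (X 0F) (X 1F)) (X 1F) (X 0F)) (Y 0F)
        {r Vector.∷ r Vector.∷ Vector.[]} {r Vector.∷ 𝟎 Vector.∷ Vector.[]}
        {λ _ → r} {λ _ → a} (λ _ → rαa)
        (trans (d-cong≡ d-yyx refl refl) d-yyx)
        (trans (d-cong≡ d-xyy refl refl) d-xyy)
        (trans (d-cong≡ d-yyx refl refl) d-yyx)

      lin-𝟎 : ∀ f → lin f (λ _ → 𝟎) ≡ 𝟎
      lin-𝟎 f = d-yyx

      linP : ∀ {m n} f → (Fin (arity f) → Poly m n) → Poly m n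
      linP f ps = D (F f ps) (F f (λ _ → cst 𝟎)) (cst 𝟎)

    law : ∀ l → lhs α l ≡[ γ ] rhs α l
    law (comm x y) = rectangle {1} {1}
      (D (X 0F) (cst 𝟎) (Y 0F)) (D (Y 0F) (cst 𝟎) (X 0F))
      {λ _ → 𝟎} {λ _ → c x} {λ _ → 𝟎} {λ _ → c y} (λ _ → 𝟎αc y)
      refl (trans d-yyx (sym d-xyy)) (trans d-xyy (sym d-yyx))
    law (assoc x y z) = rectangle {2} {1}
      (D (D (X 0F) (cst 𝟎) (X 1F)) (cst 𝟎) (Y 0F))
      (D (X 0F) (cst 𝟎) (D (X 1F) (cst 𝟎) (Y 0F)))
      {λ _ → 𝟎} {c x Vector.∷ c y Vector.∷ Vector.[]}
      {λ _ → 𝟎} {λ _ → c z} (λ _ → 𝟎αc z)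
      (trans (d-cong≡ d-xyy refl refl) (d-cong≡ refl refl (sym d-xyy)))
      (trans (d-cong≡ d-yyx refl refl) (trans d-yyx (sym (trans d-yyx d-yyx))))
      (trans d-xyy (d-cong≡ refl refl (sym d-xyy)))
    law (inv x) = reconstruct (clamp-𝟎 α-cong x)
    law (recon a) = reconstruct (α.sym _ _ (rep-related α-cong a))
    law (add f x y) = rectangle
      (linP f (λ i → D (X i) (cst 𝟎) (Y i))) (D (linP f X) (cst 𝟎) (linP f Y))
      {λ _ → 𝟎} {c ∘ x} {λ _ → 𝟎} {c ∘ y} (λ j → 𝟎αc (y j))
      (trans (lin-ext f (λ _ → d-xyy)) (sym (trans (d-cong≡ refl refl (lin-𝟎 f)) d-xyy)))
      (trans (lin-ext f (λ _ → d-yyx)) (sym (trans (d-cong≡ (lin-𝟎 f) refl refl) d-yyx)))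
      (trans (lin-ext f (λ _ → d-xyy)) (sym (trans (d-cong≡ refl refl (lin-𝟎 f)) d-xyy)))
    law (split f l r s) = rectangle
      (D (F f (λ i → D (Y i) (cst 𝟎) (X (suc i)))) (X zero) (cst 𝟎))
      (D (linP f Y) (cst 𝟎) (D (F f (X ∘ suc)) (X zero) (cst 𝟎)))
      -- `s` starts at the value of `f` at `𝟎`: together with `r = 𝟎` this turns the left side into
      -- `lin f (c ∘ l)` and the last summand on the right into `𝟎`.
      {op f (λ _ → 𝟎) Vector.∷ (λ _ → 𝟎)} {s Vector.∷ r}
      {λ _ → 𝟎} {c ∘ l} (λ j → 𝟎αc (l j))
      (corner-𝟎 (λ _ → 𝟎))
      (trans (d-cong≡ (op-ext f (λ _ → d-xyy)) refl refl)
        (sym (trans (d-cong≡ refl refl d-yyx) d-xyy)))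
      (corner-𝟎 r)
      where
      corner-𝟎 : ∀ r {s} → d (op f (λ i → d 𝟎 𝟎 (r i))) s 𝟎 ≡
                           d (lin f (λ _ → 𝟎)) 𝟎 (d (op f r) s 𝟎)
      corner-𝟎 r = trans (d-cong≡ (op-ext f (λ _ → d-yyx)) refl refl)
        (sym (trans (d-cong≡ (lin-𝟎 f) refl refl) d-yyx))

  -- A decidable descending series below the lower central series

  module _ (γ : BRel 𝔸) where

    isCong? : Dec (IsCong 𝔸 γ)
    isCong? = map′
      (λ (r , s , t , c) → record { refl = r ; sym = s ; trans = t ; compat = c })
      (λ c → IsCong.refl c , IsCong.sym c , IsCong.trans c , IsCong.compat c)
      (all? (λ x → x ~? x) ×-dec
       all? (λ x → all? λ y → (x ~? y) →-dec (y ~? x)) ×-dec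
       all? (λ x → all? λ y → all? λ z → (x ~? y) →-dec ((y ~? z) →-dec (x ~? z))) ×-dec
       all? (λ f → ∀fun?
         (λ a≗a' h b e → subst (λ u → γ u (op f b) ≡ true) (op-ext f a≗a')
           (h b (λ i → subst (λ u → γ u (b i) ≡ true) (sym (a≗a' i)) (e i))))
         (λ a → ∀fun?
           (λ b≗b' h e → subst (λ u → γ (op f a) u ≡ true) (op-ext f b≗b')
             (h (λ i → subst (λ u → γ (a i) u ≡ true) (sym (b≗b' i)) (e i))))
           (λ b → all? (λ i → a i ~? b i) →-dec (op f a ~? op f b)))))
      where
      _~?_ : ∀ x y → Dec (γ x y ≡ true)
      x ~? y = γ x y Bool.≟ true

    laws? : ∀ α → Dec (∀ l → lhs α l ≡[ γ ] rhs α l)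
    laws? α = map′
      (λ { (c , a , i , r , d , s) →
           λ { (comm x y) → c x y ; (assoc x y z) → a x y z ; (inv x) → i x
             ; (recon x) → r x ; (add f x y) → d f x y ; (split f l r' s') → s f l r' s' } })
      (λ h → (λ x y → h (comm x y)) , (λ x y z → h (assoc x y z)) , (λ x → h (inv x)) ,
             (λ x → h (recon x)) , (λ f x y → h (add f x y)) ,
             (λ f l r s → h (split f l r s)))
      (all? (λ x → all? λ y → law? (comm x y)) ×-dec
       all? (λ x → all? λ y → all? λ z → law? (assoc x y z)) ×-dec
       all? (λ x → law? (inv x)) ×-dec
       all? (λ x → law? (recon x)) ×-dec
       all? (λ f → ∀fun? (λ x≗x' h y → resp (add f _ y) (add f _ y)
                (lin-ext f (λ i → d-cong≡ (cong c (x≗x' i)) refl refl))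
                (d-cong≡ (lin-ext f (λ i → cong c (x≗x' i))) refl refl) (h y))
         λ x → ∀fun? (λ y≗y' → resp (add f x _) (add f x _)
                (lin-ext f (λ i → d-cong≡ refl refl (cong c (y≗y' i))))
                (d-cong≡ refl refl (lin-ext f (λ i → cong c (y≗y' i)))))
         λ y → law? (add f x y)) ×-dec
       all? (λ f → ∀fun? (λ l≗l' h r s → resp (split f _ r s) (split f _ r s)
                (d-cong≡ (op-ext f (λ i → d-cong≡ (cong c (l≗l' i)) refl refl)) refl refl)
                (d-cong≡ (lin-ext f (λ i → cong c (l≗l' i))) refl refl) (h r s))
         λ l → ∀fun? (λ r≗r' h s → resp (split f l _ s) (split f l _ s)
                (d-cong≡ (op-ext f (λ i → d-cong≡ refl refl (r≗r' i))) refl refl)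
                (d-cong≡ refl refl (d-cong≡ (op-ext f r≗r') refl refl)) (h s))
         λ r → all? λ s → law? (split f l r s)))
      where
      c : A → A
      c = clamp α
      law? : ∀ l → Dec (lhs α l ≡[ γ ] rhs α l)
      law? l = γ _ _ Bool.≟ true
      resp : ∀ l l' → lhs α l ≡ lhs α l' → rhs α l ≡ rhs α l' →
             lhs α l ≡[ γ ] rhs α l → lhs α l' ≡[ γ ] rhs α l'
      resp _ _ = subst₂ (λ a b → γ a b ≡ true)

  -- Whether α is central modulo γ is a question about all terms, with no evident
  -- decision procedure.  The laws can be decided, and the least congruence
  -- satisfying them lies below the commutator of α with the total relation.
  Good : BRel 𝔸 → BRel 𝔸 → Set
  Good α γ = IsCong 𝔸 γ × (∀ l → lhs α l ≡[ γ ] rhs α l)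

  Good-resp : ∀ {α γ γ'} → (∀ x y → γ x y ≡ γ' x y) → Good α γ → Good α γ'
  Good-resp {γ = γ} {γ'} γ≗γ' (c , h) = record
    { refl = λ x → to (C.refl x)
    ; sym = λ x y e → to (C.sym x y (from e))
    ; trans = λ x y z e e' → to (C.trans x y z (from e) (from e'))
    ; compat = λ f a b e → to (C.compat f a b (λ i → from (e i)))
    } , λ l → to (h l)
    where
    module C = IsCong c
    to : ∀ {x y} → x ≡[ γ ] y → x ≡[ γ' ] y
    to e = trans (sym (γ≗γ' _ _)) e
    from : ∀ {x y} → x ≡[ γ' ] y → x ≡[ γ ] y
    from e = trans (γ≗γ' _ _) e

  private
    Code : Set
    Code = Fin ((2 ^ size) ^ size)

    bit : Bool → Fin 2
    bit b = if b then 1F else 0F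

    isOne : Fin 2 → Bool
    isOne 0F = false
    isOne 1F = true

    isOne-bit : ∀ b → isOne (bit b) ≡ b
    isOne-bit false = refl
    isOne-bit true = refl

    decode : Code → BRel 𝔸
    decode k x y = isOne (finToFun {2} {size} (finToFun k x) y)

    encode : BRel 𝔸 → Code
    encode γ = funToFin {size} {2 ^ size} (λ x → funToFin {size} {2} (λ y → bit (γ x y)))

    decode-encode : ∀ γ x y → decode (encode γ) x y ≡ γ x y
    decode-encode γ x y = trans
      (cong (λ k → isOne (finToFun {2} {size} k y)) (finToFun-funToFin _ x))
      (trans (cong isOne (finToFun-funToFin _ y)) (isOne-bit (γ x y)))

    inAll? : ∀ α x y → Dec (∀ k → Good α (decode k) → x ≡[ decode k ] y)
    inAll? α x y = all? λ k →
      (isCong? (decode k) ×-dec laws? (decode k) α) →-dec (decode k x y Bool.≟ true)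

  meet : BRel 𝔸 → BRel 𝔸
  meet α x y = does (inAll? α x y)

  -- The meet ranges over codes only, and `γ` agrees with its recoding merely pointwise, so goodness
  -- has to be transported by `Good-resp`.
  meet-lower : ∀ {α γ} → Good α γ → ∀ {x y} → x ≡[ meet α ] y → x ≡[ γ ] y
  meet-lower {α} {γ} good {x} {y} e = trans (sym (decode-encode γ x y))
    (dec-witness (inAll? α x y) e (encode γ) (Good-resp (λ x y → sym (decode-encode γ x y)) good))

  meet-greatest : ∀ {α x y} → (∀ γ → Good α γ → x ≡[ γ ] y) → x ≡[ meet α ] y
  meet-greatest {α} h = dec-true (inAll? α _ _) (λ k → h (decode k))

  meet-good : ∀ α → Good α (meet α)
  meet-good α = record
    { refl = λ x → meet-greatest λ γ (c , _) → IsCong.refl c x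
    ; sym = λ x y e → meet-greatest λ γ g →
        IsCong.sym (proj₁ g) x y (meet-lower g e)
    ; trans = λ x y z e e' → meet-greatest λ γ g →
        IsCong.trans (proj₁ g) x y z (meet-lower g e) (meet-lower g e')
    ; compat = λ f a b e → meet-greatest λ γ g →
        IsCong.compat (proj₁ g) f a b (λ i → meet-lower g (e i))
    } , λ l → meet-greatest λ γ (_ , h) → h l

  level : ℕ → BRel 𝔸
  level zero x y = true
  level (suc i) = meet (level i)

  level-cong : ∀ i → IsCong 𝔸 (level i)
  level-cong zero = record
    { refl = λ _ → refl ; sym = λ _ _ _ → refl
    ; trans = λ _ _ _ _ _ → refl ; compat = λ _ _ _ _ → refl }
  level-cong (suc i) = proj₁ (meet-good (level i))

  -- If `lowerCentral i` is central modulo `γ`, so is the smaller `level i`. By `Rectangle.law` such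
  -- a `γ` is good, hence lies above the meet.
  level⊆lowerCentral : ∀ i {x y} → x ≡[ level i ] y → lowerCentral 𝔸 i x y
  level⊆lowerCentral zero _ = tt
  level⊆lowerCentral (suc i) e γ γ-cong central = meet-lower
    (γ-cong , Rectangle.law (level-cong i) γ-cong
      (λ m n t a a' b b' p q → central m n t a a' b b' p
        (λ j → level⊆lowerCentral i (q j)))) e

-- The algebra modulo the kernel of u' as an extension of the algebra modulo the
-- kernel of u by an abelian group, on which all operations act affinely.
record Extension (𝔸 : FinAlgebra) (u u' : Carrier 𝔸 → Carrier 𝔸) : Set₁ where
  open FinAlgebra 𝔸
  field
    _≈_ : Carrier 𝔸 → Carrier 𝔸 → Set
    _∙_ : Carrier 𝔸 → Carrier 𝔸 → Carrier 𝔸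
    ε : Carrier 𝔸
    _⁻¹ : Carrier 𝔸 → Carrier 𝔸
    isAbelianGroup : IsAbelianGroup _≈_ _∙_ ε _⁻¹
    lin : ∀ f → (Fin (arity f) → Carrier 𝔸) → Carrier 𝔸
    lin-cong : ∀ f {x y} → (∀ i → x i ≈ y i) → lin f x ≈ lin f y
    lin-∙ : ∀ f x y → lin f (λ i → x i ∙ y i) ≈ (lin f x ∙ lin f y)
    lin-ε : ∀ f → lin f (λ _ → ε) ≈ ε
    ℓ : Carrier 𝔸 → Carrier 𝔸
    ℓ-op : ∀ f a → ℓ (op f a) ≈ (lin f (ℓ ∘ a) ∙ ℓ (op f (u ∘ a)))
    assemble : Carrier 𝔸 → Carrier 𝔸 → Carrier 𝔸
    assemble-cong : ∀ {x y} a → x ≈ y → assemble x a ≡ assemble y a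
    assemble-ℓ : ∀ a → assemble (ℓ a) (u a) ≡ u' a

-- The abelian group and the affine coordinates of one central step

module _
  (𝔸 : FinAlgebra) (op-ext : OpExt 𝔸) (malcev : IsMalcev 𝔸)
  (𝟎 : Carrier 𝔸) where

  open FinAlgebra 𝔸
  open Malcev 𝔸 op-ext malcev 𝟎

  -- An element stands for its clamped value, and `≈` compares clamped values modulo `γ`. The fields
  -- are the laws up to clamps around values already in the class of `𝟎`, which `fix` removes.
  good⇒extension : ∀ {α γ} → IsCong 𝔸 α → Good α γ → Extension 𝔸 (rep α) (rep γ)
  good⇒extension {α} {γ} α-cong (γ-cong , law) = record
    { _≈_ = _≈_
    ; _∙_ = _∙_
    ; ε = 𝟎
    ; _⁻¹ = λ x → d 𝟎 (c x) 𝟎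
    ; isAbelianGroup = record
      { isGroup = record
        { isMonoid = record
          { isSemigroup = record
            { isMagma = record
              { isEquivalence = record
                { refl = γ.refl _ ; sym = γ.sym _ _ ; trans = γ.trans _ _ _ }
              ; ∙-cong = λ {x} {x'} {y} {y'} e e' → close₂ (inClass-⊕ x y) (inClass-⊕ x' y')
                  (d-cong γ-cong e (γ.refl 𝟎) e')
              }
            ; assoc = λ x y z → close₂ (inClass-⊕ (x ∙ y) z) (inClass-⊕ x (y ∙ z))
                (subst₂ (λ a b → γ a b ≡ true)
                  (d-cong≡ (sym (fix (inClass-⊕ x y))) refl refl)
                  (d-cong≡ refl refl (sym (fix (inClass-⊕ y z))))
                  (law (assoc x y z)))
            }
          ; identity = (λ x → γ-refl (trans (fix (inClass-⊕ 𝟎 x))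
                         (trans (d-cong≡ c𝟎 refl refl) d-yyx)))
                     , (λ x → γ-refl (trans (fix (inClass-⊕ x 𝟎))
                         (trans (d-cong≡ refl refl c𝟎) d-xyy)))
          }
        ; inverse = inverseˡ
                  , λ x → γ.trans _ _ _ (∙-comm x _) (inverseˡ x)
        ; ⁻¹-cong = λ {x} {y} e → close₂ (inClass-⁻¹ x) (inClass-⁻¹ y)
            (d-cong γ-cong (γ.refl 𝟎) e (γ.refl 𝟎))
        }
      ; comm = ∙-comm
      }
    ; lin = λ f x → lin f (c ∘ x)
    ; lin-cong = λ f {x} {y} e → close₂ (inClass-lin f x) (inClass-lin f y)
        (d-cong γ-cong (γ.compat f _ _ e) (γ.refl _) (γ.refl _))
    ; lin-∙ = λ f x y → close₂ (inClass-lin f (λ i → x i ∙ y i))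
          (inClass-⊕ (lin f (c ∘ x)) (lin f (c ∘ y)))
        (subst₂ (λ a b → γ a b ≡ true)
          (lin-ext f (λ i → sym (fix (inClass-⊕ (x i) (y i)))))
          (d-cong≡ (sym (fix (inClass-lin f x))) refl
            (sym (fix (inClass-lin f y))))
          (law (add f x y)))
    ; lin-ε = λ f → close₂ (inClass-lin f (λ _ → 𝟎)) (α.refl 𝟎)
        (γ-refl (trans (lin-ext f (λ _ → c𝟎)) d-yyx))
    ; ℓ = ℓ
    ; ℓ-op = ℓ-op
    ; assemble = λ x a → rep γ (d (c x) 𝟎 a)
    ; assemble-cong = λ a e → rep-unique γ-cong (d-cong γ-cong e (γ.refl _) (γ.refl _))
    ; assemble-ℓ = λ a → rep-unique γ-cong
        (subst (λ x → γ (d x 𝟎 (rep α a)) a ≡ true) (sym (fix (inClass-ℓ a)))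
          (law (recon a)))
    }
    where
    module α = IsCong α-cong
    module γ = IsCong γ-cong

    c ℓ : A → A
    c = clamp α
    ℓ a = d a (rep α a) 𝟎

    _≈_ : A → A → Set
    x ≈ y = c x ≡[ γ ] c y

    _∙_ : A → A → A
    x ∙ y = d (c x) 𝟎 (c y)

    γ-refl : ∀ {x y} → x ≡ y → x ≡[ γ ] y
    γ-refl refl = γ.refl _

    fix : ∀ {x} → x ≡[ α ] 𝟎 → c x ≡ x
    fix = clamp-id {α}

    c𝟎 : c 𝟎 ≡ 𝟎
    c𝟎 = fix (α.refl 𝟎)

    inClass : ∀ x → c x ≡[ α ] 𝟎
    inClass = clamp-𝟎 α-cong

    close₂ : ∀ {x y} → x ≡[ α ] 𝟎 → y ≡[ α ] 𝟎 → x ≡[ γ ] y → x ≈ y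
    close₂ p q = subst₂ (λ a b → γ a b ≡ true) (sym (fix p)) (sym (fix q))

    inClass-⊕ : ∀ x y → d (c x) 𝟎 (c y) ≡[ α ] 𝟎
    inClass-⊕ x y = subst (λ z → α (d (c x) 𝟎 (c y)) z ≡ true) d-xyy
      (d-cong α-cong (inClass x) (α.refl 𝟎) (inClass y))

    inClass-⁻¹ : ∀ x → d 𝟎 (c x) 𝟎 ≡[ α ] 𝟎
    inClass-⁻¹ x = subst (λ z → α (d 𝟎 (c x) 𝟎) z ≡ true) d-xyy
      (d-cong α-cong (α.refl 𝟎) (inClass x) (α.refl 𝟎))

    inClass-lin : ∀ f x → lin f (c ∘ x) ≡[ α ] 𝟎
    inClass-lin f x = subst (λ z → α (lin f (c ∘ x)) z ≡ true) d-yyx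
      (d-cong α-cong (α.compat f _ _ (inClass ∘ x)) (α.refl _) (α.refl 𝟎))

    inClass-ℓ : ∀ a → ℓ a ≡[ α ] 𝟎
    inClass-ℓ a = subst (λ z → α (ℓ a) z ≡ true) d-yyx
      (d-cong α-cong (rep-related α-cong a) (α.refl _) (α.refl 𝟎))

    ∙-comm : ∀ x y → (x ∙ y) ≈ (y ∙ x)
    ∙-comm x y = close₂ (inClass-⊕ x y) (inClass-⊕ y x) (law (comm x y))

    inverseˡ : ∀ x → (d 𝟎 (c x) 𝟎 ∙ x) ≈ 𝟎
    inverseˡ x = close₂ (inClass-⊕ (d 𝟎 (c x) 𝟎) x) (α.refl 𝟎)
      (subst (λ z → γ (d z 𝟎 (c x)) 𝟎 ≡ true) (sym (fix (inClass-⁻¹ x)))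
        (law (inv x)))

    -- By `recon` each argument is its coordinate plus its representative; `split` separates the
    -- two. Since `α` is a congruence, replacing the arguments by their representatives does not
    -- change the representative of the value.
    ℓ-op : ∀ f a → ℓ (op f a) ≈ (lin f (c ∘ ℓ ∘ a) ∙ ℓ (op f (rep α ∘ a)))
    ℓ-op f a = close₂ (inClass-ℓ (op f a))
      (inClass-⊕ (lin f (c ∘ ℓ ∘ a)) (ℓ (op f (rep α ∘ a)))) (γ.trans _ _ _
      (d-cong γ-cong (γ.sym _ _ (γ.compat f _ _ (λ i →
          subst (λ x → γ (d x 𝟎 (rep α (a i))) (a i) ≡ true)
            (sym (fix (inClass-ℓ (a i)))) (law (recon (a i))))))
        (γ.refl _) (γ.refl 𝟎))
      (subst (λ y → γ (d (op f (λ i → d (c (ℓ (a i))) 𝟎 (rep α (a i))))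
                         (rep α (op f a)) 𝟎) y ≡ true)
        (d-cong≡ (sym (fix (inClass-lin f (ℓ ∘ a)))) refl
          (trans
            (d-cong≡ refl
              (rep-unique α-cong (α.compat f _ _ (λ i → rep-related α-cong (a i)))) refl)
            (sym (fix (inClass-ℓ (op f (rep α ∘ a)))))))
        (law (split f (ℓ ∘ a) (rep α ∘ a) (rep α (op f a))))))

-- Finite sums, maxima and residues

sumF-cong : ∀ s {f g : Fin s → ℕ} → f ≗ g → sumF s f ≡ sumF s g
sumF-cong zero f≗g = refl
sumF-cong (suc s) f≗g = cong₂ _+_ (f≗g zero) (sumF-cong s (f≗g ∘ suc))

sumF-zero : ∀ s → sumF s (λ _ → 0) ≡ 0
sumF-zero zero = refl
sumF-zero (suc s) = sumF-zero s

sumF-+ : ∀ s (f g : Fin s → ℕ) → sumF s (λ i → f i + g i) ≡ sumF s f + sumF s g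
sumF-+ zero f g = refl
sumF-+ (suc s) f g =
  trans (cong (f zero + g zero +_) (sumF-+ s (f ∘ suc) (g ∘ suc))) (interchange (f zero) (g zero) _ _)
  where
  interchange : ∀ a b c d → a + b + (c + d) ≡ a + c + (b + d)
  interchange = solve-∀

sumF-↑ : ∀ a b (f : Fin (a + b) → ℕ) →
         sumF (a + b) f ≡ sumF a (f ∘ (_↑ˡ b)) + sumF b (f ∘ (a ↑ʳ_))
sumF-↑ zero b f = refl
sumF-↑ (suc a) b f =
  trans (cong (f zero +_) (sumF-↑ a b (f ∘ suc))) (sym (+-assoc (f zero) _ _))

sumF-combine : ∀ a b (f : Fin (a * b) → ℕ) →
               sumF (a * b) f ≡ sumF a (λ i → sumF b (λ j → f (combine i j)))
sumF-combine zero b f = refl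
sumF-combine (suc a) b f =
  trans (sumF-↑ b (a * b) f) (cong (sumF b (λ j → f (j ↑ˡ (a * b))) +_)
    (sumF-combine a b (f ∘ (b ↑ʳ_))))

sumF-δ : ∀ {s} (i : Fin s) (f : Fin s → ℕ) →
         sumF s (λ j → if does (i ≟ j) then f j else 0) ≡ f i
sumF-δ {suc s} zero f = trans (cong (f zero +_) (sumF-zero s)) (+-identityʳ _)
sumF-δ {suc s} (suc i) f = sumF-δ i (f ∘ suc)

sumF-< : ∀ {s a} → a ≤ s → sumF s (λ t → if toℕ t <ᵇ a then 1 else 0) ≡ a
sumF-< {s} z≤n = trans (sumF-cong s (λ _ → refl)) (sumF-zero s)
sumF-< (s≤s a≤s) = cong suc (sumF-< a≤s)

sumF-% : ∀ s (f : Fin s → ℕ) m .{{_ : NonZero m}} → sumF s (λ i → f i % m) % m ≡ sumF s f % m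
sumF-% zero f m = refl
sumF-% (suc s) f m = begin
  (f zero % m + sumF s (λ i → f (suc i) % m)) % m
    ≡⟨ %-distribˡ-+ (f zero % m) _ m ⟩
  (f zero % m % m + sumF s (λ i → f (suc i) % m) % m) % m
    ≡⟨ cong₂ (λ a b → (a + b) % m) (m%n%n≡m%n (f zero) m) (sumF-% s (f ∘ suc) m) ⟩
  (f zero % m + sumF s (f ∘ suc) % m) % m
    ≡⟨ %-distribˡ-+ (f zero) _ m ⟨
  (f zero + sumF s (f ∘ suc)) % m ∎
  where open ≡-Reasoning

maxF-≤ : ∀ s {f : Fin s → ℕ} {D} → (∀ i → f i ≤ D) → maxF s f ≤ D
maxF-≤ zero f≤D = z≤n
maxF-≤ (suc s) f≤D = ⊔-lub (f≤D zero) (maxF-≤ s (f≤D ∘ suc))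

toℕ-mod : ∀ a m .{{_ : NonZero m}} → toℕ (a mod m) ≡ a % m
toℕ-mod a m = toℕ-fromℕ< (m%n<n a m)

mod-cong : ∀ a b m .{{_ : NonZero m}} → a % m ≡ b % m → a mod m ≡ b mod m
mod-cong a b m e = toℕ-injective (trans (toℕ-mod a m) (trans e (sym (toℕ-mod b m))))

toℕ-mod-id : ∀ {m} .{{_ : NonZero m}} (i : Fin m) → toℕ i mod m ≡ i
toℕ-mod-id {m} i = toℕ-injective (trans (toℕ-mod (toℕ i) m) (m<n⇒m%n≡m (toℕ<n i)))

count : (s : ℕ) → (Fin s → Bool) → (Fin s → Bool) → ℕ
count s ins b = sumF s (λ j → if ins j ∧ b j then 1 else 0)

-- Layers of MOD gates and one-hot signals

module Layers (m-1 n : ℕ) where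

  m : ℕ
  m = suc m-1

  Input : Set
  Input = Fin n → Bool

  none : ∀ {k} → Fin k → Bool
  none _ = false

  -- Each new gate reads nodes of `c` only and none of its fellow new gates, so all `k` of them
  -- together cost one unit of depth.
  addGates : ∀ {s} k → (Fin k → Fin m → Bool) → (Fin k → Fin s → Bool) →
             MCirc m n s → MCirc m n (k + s)
  addGates zero T ins c = c
  addGates (suc k) T ins c =
    modg (T zero) (none {k} Vector.++ ins zero) ∷ addGates k (T ∘ suc) (ins ∘ suc) c

  module _ {s : ℕ} (c : MCirc m n s) where

    vals-old : ∀ k T ins w i → mVals (addGates k T ins c) w (k ↑ʳ i) ≡ mVals c w i
    vals-old zero T ins w i = refl
    vals-old (suc k) T ins w i = vals-old k (T ∘ suc) (ins ∘ suc) w i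

    vals-new : ∀ k T ins w j → mVals (addGates k T ins c) w (j ↑ˡ s) ≡
                               T j (count s (ins j) (mVals c w) mod m)
    vals-new (suc k) T ins w (suc j) = vals-new k (T ∘ suc) (ins ∘ suc) w j
    vals-new (suc k) T ins w zero = cong (λ a → T zero (a mod m)) (begin
      count (k + s) (none Vector.++ ins zero) v
        ≡⟨ sumF-↑ k s _ ⟩
      sumF k (λ i → if (none Vector.++ ins zero) (i ↑ˡ s) ∧ v (i ↑ˡ s) then 1 else 0) +
      sumF s (λ i → if (none Vector.++ ins zero) (k ↑ʳ i) ∧ v (k ↑ʳ i) then 1 else 0)
        ≡⟨ cong₂ _+_
             (trans (sumF-cong k λ i → cong (λ b → if b ∧ v (i ↑ˡ s) then 1 else 0)
                (lookup-++ˡ (none {k}) (ins zero) i)) (sumF-zero k))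
             (sumF-cong s λ i → cong₂ (λ b b' → if b ∧ b' then 1 else 0)
                (lookup-++ʳ (none {k}) (ins zero) i)
                (vals-old k (T ∘ suc) (ins ∘ suc) w i)) ⟩
      count s (ins zero) (mVals c w) ∎)
      where
      open ≡-Reasoning
      v = mVals (addGates k (T ∘ suc) (ins ∘ suc) c) w

    depths-old : ∀ k T ins i → mDepths (addGates k T ins c) (k ↑ʳ i) ≡ mDepths c i
    depths-old zero T ins i = refl
    depths-old (suc k) T ins i = depths-old k (T ∘ suc) (ins ∘ suc) i

    depths-new : ∀ k T ins {D} → (∀ j i → ins j i ≡ true → mDepths c i ≤ D) →
                 ∀ j → mDepths (addGates k T ins c) (j ↑ˡ s) ≤ suc D
    depths-new (suc k) T ins h (suc j) = depths-new k (T ∘ suc) (ins ∘ suc) (h ∘ suc) j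
    depths-new (suc k) T ins {D} h zero = s≤s (maxF-≤ (k + s) bound)
      where
      bound : ∀ i → (if (none {k} Vector.++ ins zero) i
                     then mDepths (addGates k (T ∘ suc) (ins ∘ suc) c) i else 0) ≤ D
      bound i = subst
        (λ i → (if (none {k} Vector.++ ins zero) i
                then mDepths (addGates k (T ∘ suc) (ins ∘ suc) c) i else 0) ≤ D)
        (join-splitAt k s i) (at (splitAt k i))
        where
        at : ∀ (x : Fin k ⊎ Fin s) → (if (none {k} Vector.++ ins zero) (join k s x)
                 then mDepths (addGates k (T ∘ suc) (ins ∘ suc) c) (join k s x) else 0) ≤ D
        at (inj₁ i) rewrite lookup-++ˡ (none {k}) (ins zero) i = z≤n
        at (inj₂ i) rewrite lookup-++ʳ (none {k}) (ins zero) i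
                          | depths-old k (T ∘ suc) (ins ∘ suc) i with ins zero i in eq
        ... | true = h zero i eq
        ... | false = z≤n

  record Bits (P : ℕ) (B : Input → Fin P → Bool) (Z D : ℕ) : Set where
    field
      rest    : ℕ
      circ    : MCirc m n (P + rest)
      size≤   : P + rest ≤ Z
      depth≤  : ∀ p → mDepths circ (p ↑ˡ rest) ≤ D
      correct : ∀ w p → mVals circ w (p ↑ˡ rest) ≡ B w p

  Bits-resp : ∀ {P B B' Z D} → (∀ w → B w ≗ B' w) → Bits P B Z D → Bits P B' Z D
  Bits-resp B≗B' b = record
    { rest = rest ; circ = circ ; size≤ = size≤ ; depth≤ = depth≤
    ; correct = λ w p → trans (correct w p) (B≗B' w p) }
    where open Bits b

  inputBits : Bits n (λ w → w) n 0
  inputBits = record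
    { rest = 0 ; circ = inputs n (λ i → i)
    ; size≤ = ≤-reflexive (+-identityʳ n)
    ; depth≤ = λ p → ≤-reflexive (inputs-depth n (λ i → i) p)
    ; correct = λ w p → inputs-val n (λ i → i) w p }
    where
    inputs : ∀ k → (Fin k → Fin n) → MCirc m n (k + 0)
    inputs zero e = []
    inputs (suc k) e = input (e zero) ∷ inputs k (e ∘ suc)
    inputs-depth : ∀ k e p → mDepths (inputs k e) (p ↑ˡ 0) ≡ 0
    inputs-depth (suc k) e zero = refl
    inputs-depth (suc k) e (suc p) = inputs-depth k (e ∘ suc) p
    inputs-val : ∀ k e w p → mVals (inputs k e) w (p ↑ˡ 0) ≡ w (e p)
    inputs-val (suc k) e w zero = refl
    inputs-val (suc k) e w (suc p) = inputs-val k (e ∘ suc) w p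

  modLayer : ∀ {P B Z D} → Bits P B Z D →
             ∀ P' (T : Fin P' → Fin m → Bool) (ins : Fin P' → Fin P → Bool) →
             Bits P' (λ w j → T j (count P (ins j) (B w) mod m)) (P' + Z) (suc D)
  modLayer {P} {B} {Z} {D} b P' T ins = record
    { rest = P + rest
    ; circ = addGates P' T ins' circ
    ; size≤ = +-monoʳ-≤ P' size≤
    ; depth≤ = depths-new circ P' T ins' used
    ; correct = λ w j → trans (vals-new circ P' T ins' w j)
        (cong (λ a → T j (a mod m)) (begin
          count (P + rest) (ins' j) (mVals circ w)
            ≡⟨ sumF-↑ P rest _ ⟩
          sumF P (λ i → if ins' j (i ↑ˡ rest) ∧ mVals circ w (i ↑ˡ rest) then 1 else 0) +
          sumF rest (λ i → if ins' j (P ↑ʳ i) ∧ mVals circ w (P ↑ʳ i) then 1 else 0)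
            ≡⟨ cong₂ _+_
                 (sumF-cong P λ i → cong₂ (λ b b' → if b ∧ b' then 1 else 0)
                   (lookup-++ˡ (ins j) (none {rest}) i) (correct w i))
                 (trans (sumF-cong rest λ i →
                   cong (λ b → if b ∧ mVals circ w (P ↑ʳ i) then 1 else 0)
                     (lookup-++ʳ (ins j) (none {rest}) i)) (sumF-zero rest)) ⟩
          count P (ins j) (B w) + 0
            ≡⟨ +-identityʳ _ ⟩
          count P (ins j) (B w) ∎))
    }
    where
    open ≡-Reasoning
    open Bits b
    ins' : Fin P' → Fin (P + rest) → Bool
    ins' j = ins j Vector.++ none {rest}
    used : ∀ j i → ins' j i ≡ true → mDepths circ i ≤ D
    used j i = subst (λ i → ins' j i ≡ true → mDepths circ i ≤ D)
      (join-splitAt P rest i) (at (splitAt P i))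
      where
      at : (x : Fin P ⊎ Fin rest) →
           ins' j (join P rest x) ≡ true → mDepths circ (join P rest x) ≤ D
      at (inj₁ i) _ = depth≤ i
      at (inj₂ i) e with () ← trans (sym (lookup-++ʳ (ins j) (none {rest}) i)) e

  -- A family of N signals with values in Fin q is presented in one-hot form,
  -- each bit occurring m times: a gate cannot use a node more than once, and the
  -- copies allow arbitrary weights modulo m.

  module _ (N q : ℕ) where

    node : Fin (N * (q * m)) → Fin N
    node p = proj₁ (remQuot (q * m) p)

    value : Fin (N * (q * m)) → Fin q
    value p = proj₁ (remQuot m (proj₂ (remQuot {N} (q * m) p)))

    copy : Fin (N * (q * m)) → Fin m
    copy p = proj₂ (remQuot {q} m (proj₂ (remQuot {N} (q * m) p)))

    oneHot : (Fin N → Fin q) → Fin (N * (q * m)) → Bool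
    oneHot X p = does (X (node p) ≟ value p)

    record Signals (X : Input → Fin N → Fin q) (Z D : ℕ) : Set where
      constructor signals
      field bits : Bits (N * (q * m)) (λ w → oneHot (X w)) Z D

    weights : (Fin N → Fin q → ℕ) → Fin (N * (q * m)) → Bool
    weights W p = toℕ (copy p) <ᵇ (W (node p) (value p) % m)

    -- For node `v` only the copies of the value `X v` are on, and the threshold in `weights`
    -- selects `W v (X v) % m` of these `m` copies.
    count-weights : ∀ W X → count (N * (q * m)) (weights W) (oneHot X) % m ≡
                            sumF N (λ v → W v (X v)) % m
    count-weights W X = trans (cong (_% m) (begin
      count (N * (q * m)) (weights W) (oneHot X)
        ≡⟨ sumF-combine N (q * m) _ ⟩
      sumF N (λ v → sumF (q * m) (λ r → term (combine v r)))
        ≡⟨ sumF-cong N (λ v → trans (sumF-combine q m _) (trans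
             (sumF-cong q (λ c → trans (sumF-cong m (at v c)) (guarded v c)))
             (sumF-δ (X v) (λ c → W v c % m)))) ⟩
      sumF N (λ v → W v (X v) % m) ∎)) (sumF-% N (λ v → W v (X v)) m)
      where
      open ≡-Reasoning
      term : Fin (N * (q * m)) → ℕ
      term p = if weights W p ∧ oneHot X p then 1 else 0
      at : ∀ v c t → term (combine v (combine c t)) ≡
           (if (toℕ t <ᵇ (W v c % m)) ∧ does (X v ≟ c) then 1 else 0)
      at v c t = trans
        (cong (λ (v , r) → term′ v (remQuot {q} m r)) (remQuot-combine v (combine c t)))
        (cong (term′ v) (remQuot-combine c t))
        where
        term′ : Fin N → Fin q × Fin m → ℕ
        term′ v (c , t) = if (toℕ t <ᵇ (W v c % m)) ∧ does (X v ≟ c) then 1 else 0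
      guarded : ∀ v c →
        sumF m (λ t → if (toℕ t <ᵇ (W v c % m)) ∧ does (X v ≟ c) then 1 else 0) ≡
        (if does (X v ≟ c) then W v c % m else 0)
      guarded v c with does (X v ≟ c)
      ... | true = trans (sumF-cong m (λ t → ∧-true (toℕ t <ᵇ (W v c % m))))
                     (sumF-< (<⇒≤ (m%n<n (W v c) m)))
        where
        ∧-true : ∀ b → (if b ∧ true then 1 else 0) ≡ (if b then 1 else 0)
        ∧-true true = refl
        ∧-true false = refl
      ... | false = trans (sumF-cong m (λ t → ∧-false (toℕ t <ᵇ (W v c % m)))) (sumF-zero m)
        where
        ∧-false : ∀ b → (if b ∧ false then 1 else 0) ≡ 0
        ∧-false true = refl
        ∧-false false = refl

  open Signals

  Signals-resp : ∀ {N q X X' Z D} → (∀ w → X w ≗ X' w) → Signals N q X Z D → Signals N q X' Z D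
  Signals-resp {N} {q} X≗X' sig = signals (Bits-resp
    (λ w p → cong (λ x → does (x ≟ value N q p)) (X≗X' w (node N q p))) (bits sig))

  inputSignals : ∀ N q (S : Fin N → Fin n → Bool) (τ : Fin N → Fin m → Fin q) →
                 Signals N q (λ w v → τ v (count n (S v) w mod m)) (N * (q * m) + n) 1
  inputSignals N q S τ = signals (modLayer inputBits (N * (q * m))
    (λ p r → does (τ (node N q p) r ≟ value N q p)) (λ p → S (node N q p)))

  module _ {N q X Z D} (sig : Signals N q X Z D) where

    weightedBits : ∀ P (W : Fin P → Fin N → Fin q → ℕ) (T : Fin P → Fin m → Bool) →
      Bits P (λ w j → T j (sumF N (λ v → W j v (X w v)) mod m)) (P + Z) (suc D)
    weightedBits P W T = Bits-resp
      (λ w j → cong (T j) (mod-cong (count (N * (q * m)) (weights N q (W j)) (oneHot N q (X w)))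
               (sumF N (λ v → W j v (X w v))) m (count-weights N q (W j) (X w))))
      (modLayer (bits sig) P T (weights N q ∘ W))

    weightedSignals : ∀ N' q' (W : Fin N' → Fin N → Fin q → ℕ)
      (τ : Fin N' → Fin m → Fin q') →
      Signals N' q' (λ w j → τ j (sumF N (λ v → W j v (X w v)) mod m)) (N' * (q' * m) + Z) (suc D)
    weightedSignals N' q' W τ = signals (weightedBits (N' * (q' * m)) (W ∘ node N' q')
      (λ p r → does (τ (node N' q' p) r ≟ value N' q' p)))

    -- Counts are kept modulo the smaller `e` because a later layer packs several of them into one
    -- number below `m`.
    countSignals : ∀ N' e .{{_ : NonZero e}} → e ∣ m → (S : Fin N' → Fin N → Fin q → ℕ) →
      Signals N' e (λ w j → sumF N (λ v → S j v (X w v)) mod e) (N' * (e * m) + Z) (suc D)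
    countSignals N' e e∣m S = Signals-resp
      (λ w j → let c = sumF N (λ v → S j v (X w v)) in mod-cong (toℕ (c mod m)) c e
        (trans (cong (_% e) (toℕ-mod c m)) (m∣n⇒o%n%m≡o%m e m c e∣m)))
      (weightedSignals N' e S (λ _ r → toℕ r mod e))

    private
      -- A node listed several times in `a` accumulates the place values of all its positions, so
      -- repeated gate inputs do no harm.
      digits : ∀ {k} → (Fin k → Fin N) → Fin N → Fin q → ℕ
      digits {zero} a v c = 0
      digits {suc k} a v c =
        (if does (a zero ≟ v) then q ^ k * toℕ c else 0) + digits (a ∘ suc) v c

      sum-digits : ∀ {k} (a : Fin k → Fin N) (x : Fin N → Fin q) →
                   sumF N (λ v → digits a v (x v)) ≡ toℕ (funToFin (x ∘ a))
      sum-digits {zero} a x = sumF-zero N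
      sum-digits {suc k} a x = begin
        sumF N (λ v → (if does (a zero ≟ v) then q ^ k * toℕ (x v) else 0) +
                      digits (a ∘ suc) v (x v))
          ≡⟨ sumF-+ N _ _ ⟩
        sumF N (λ v → if does (a zero ≟ v) then q ^ k * toℕ (x v) else 0) +
        sumF N (λ v → digits (a ∘ suc) v (x v))
          ≡⟨ cong₂ _+_ (sumF-δ (a zero) (λ v → q ^ k * toℕ (x v))) (sum-digits (a ∘ suc) x) ⟩
        q ^ k * toℕ (x (a zero)) + toℕ (funToFin (x ∘ a ∘ suc))
          ≡⟨ toℕ-combine (x (a zero)) (funToFin (x ∘ a ∘ suc)) ⟨
        toℕ (funToFin (x ∘ a)) ∎
        where open ≡-Reasoning

    -- The values of k signals are read as the base q digits of a weighted sum
    -- less than q ^ k ≤ m.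
    localSignals : ∀ N' q' .{{_ : NonZero q}} (k : Fin N' → ℕ) → (∀ j → q ^ k j ≤ m) →
      (a : ∀ j → Fin (k j) → Fin N) (φ : ∀ j → (Fin (k j) → Fin q) → Fin q') →
      (∀ j {x y} → x ≗ y → φ j x ≡ φ j y) →
      Signals N' q' (λ w j → φ j (X w ∘ a j)) (N' * (q' * m) + Z) (suc D)
    localSignals N' q' k q^k≤m a φ φ-ext = Signals-resp
      (λ w j → φ-ext j (λ i → trans (cong (λ z → finToFun z i) (decode w j))
                                    (finToFun-funToFin (X w ∘ a j) i)))
      (weightedSignals N' q' (digits ∘ a)
        (λ j r → φ j (finToFun (_mod_ (toℕ r) (q ^ k j) {{m^n≢0 q (k j)}}))))
      where
      decode : ∀ w j →
        _mod_ (toℕ (sumF N (λ v → digits (a j) v (X w v)) mod m)) (q ^ k j) {{m^n≢0 q (k j)}}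
        ≡ funToFin (X w ∘ a j)
      decode w j = trans
        (cong (λ z → _mod_ z (q ^ k j) {{m^n≢0 q (k j)}})
          (trans (toℕ-mod (sumF N (λ v → digits (a j) v (X w v))) m)
            (trans (cong (_% m) (sum-digits (a j) (X w)))
            (m<n⇒m%n≡m (<-≤-trans (toℕ<n (funToFin (X w ∘ a j))) (q^k≤m j))))))
        (toℕ-mod-id {{m^n≢0 q (k j)}} (funToFin (X w ∘ a j)))

-- Exponents and sums in finite abelian groups

module FiniteAbelianGroup
  {q : ℕ} {_≈_ : Fin q → Fin q → Set} {_∙_ : Fin q → Fin q → Fin q} {ε : Fin q}
  {_⁻¹ : Fin q → Fin q} (isAbelianGroup : IsAbelianGroup _≈_ _∙_ ε _⁻¹) where

  G : AbelianGroup _ _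
  G = record { isAbelianGroup = isAbelianGroup }

  open AbelianGroup G using (setoid; commutativeMonoid; monoid; group; identityʳ; ∙-cong; ∙-congˡ)
    renaming (refl to ≈-refl; sym to ≈-sym; trans to ≈-trans; reflexive to ≈-reflexive)
  open Sum commutativeMonoid public using (sum; sum-cong-≋; sum-replicate-zero; ∑-distrib-+)
  open Mult monoid public using (×-homo-+; ×-assocˡ; ×-congʳ)
  open Mult monoid renaming (_×_ to _·_) using () public
  open import Relation.Binary.Reasoning.Setoid setoid

  ·-ε : ∀ n → (n · ε) ≈ ε
  ·-ε zero = ≈-refl
  ·-ε (suc n) = ≈-trans (∙-congˡ (·-ε n)) (identityʳ ε)

  ∣-·-ε : ∀ {k n x} → k ∣ n → (k · x) ≈ ε → (n · x) ≈ ε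
  ∣-·-ε {k} {x = x} (divides p refl) kx≈ε =
    ≈-trans (≈-sym (×-assocˡ x p k)) (≈-trans (×-congʳ p kx≈ε) (·-ε p))

  -- Two of the `q + 1` multiples from `0 · x` to `q · x` coincide in `Fin q`. Their difference is a
  -- positive `k ≤ q` annihilating `x`, and `k` divides `q !`.
  q!·x≈ε : ∀ x → ((q !) · x) ≈ ε
  q!·x≈ε x with i , j , i<j , ix≡jx ← pigeonhole (n<1+n q) (λ i → toℕ i · x) =
    ∣-·-ε {k} k∣q! (identityʳ-unique (toℕ i · x) (k · x) (begin
      (toℕ i · x) ∙ (k · x)  ≈⟨ ×-homo-+ x (toℕ i) k ⟨
      (toℕ i + k) · x        ≡⟨ cong (_· x) (m+[n∸m]≡n (<⇒≤ i<j)) ⟩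
      toℕ j · x              ≡⟨ ix≡jx ⟨
      toℕ i · x              ∎))
    where
    open GroupProperties group using (identityʳ-unique)
    k = toℕ j ∸ toℕ i
    k≤q : k ≤ q
    k≤q = ≤-trans (m∸n≤m (toℕ j) (toℕ i)) (≤-pred (toℕ<n j))
    k∣q! : k ∣ q !
    k∣q! = go k (m<n⇒0<n∸m i<j) k≤q
      where
      go : ∀ k → 0 < k → k ≤ q → k ∣ q !
      go (suc k) _ k≤q = ∣-trans (m∣m*n (k !)) (m≤n⇒m!∣n! k≤q)

  sum-δ : ∀ {s} (y : Fin s) (f : Fin s → Fin q) →
          sum (λ x → (if does (y ≟ x) then 1 else 0) · f x) ≈ f y
  sum-δ {suc s} zero f =
    ≈-trans (∙-cong (identityʳ (f zero)) (sum-replicate-zero s)) (identityʳ (f zero))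
  sum-δ {suc s} (suc y) f = ≈-trans (AbelianGroup.identityˡ G _) (sum-δ y (f ∘ suc))

  -- Summands are sorted by their element of `Fin q`, where equality is decidable, and not by their
  -- class under `≈`.
  sum-by-value : ∀ s (g : Fin s → Fin q) →
    sum g ≈ sum (λ x → sumF s (λ w → if does (g w ≟ x) then 1 else 0) · x)
  sum-by-value zero g = ≈-sym (sum-replicate-zero q)
  sum-by-value (suc s) g = begin
    g zero ∙ sum (g ∘ suc)
      ≈⟨ ∙-cong (≈-sym (sum-δ (g zero) (λ x → x))) (sum-by-value s (g ∘ suc)) ⟩
    sum (λ x → (if does (g zero ≟ x) then 1 else 0) · x) ∙ sum (λ x → N x · x)
      ≈⟨ ∑-distrib-+ (λ x → (if does (g zero ≟ x) then 1 else 0) · x) (λ x → N x · x) ⟨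
    sum (λ x → ((if does (g zero ≟ x) then 1 else 0) · x) ∙ (N x · x))
      ≈⟨ sum-cong-≋ (λ x → ≈-sym
           (×-homo-+ x (if does (g zero ≟ x) then 1 else 0) (N x))) ⟩
    sum (λ x → ((if does (g zero ≟ x) then 1 else 0) + N x) · x) ∎
    where
    N : Fin q → ℕ
    N x = sumF s (λ w → if does (g (suc w) ≟ x) then 1 else 0)

  %-· : ∀ e .{{_ : NonZero e}} → q ! ∣ e → ∀ n x → ((n % e) · x) ≈ (n · x)
  %-· e q!∣e n x = ≈-sym (begin
    n · x                              ≡⟨ cong (_· x) (m≡m%n+[m/n]*n n e) ⟩
    (n % e + n / e * e) · x            ≈⟨ ×-homo-+ x (n % e) (n / e * e) ⟩
    ((n % e) · x) ∙ ((n / e * e) · x)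
      ≈⟨ ∙-congˡ (∣-·-ε (∣-trans q!∣e (n∣m*n (n / e))) (q!·x≈ε x)) ⟩
    ((n % e) · x) ∙ ε                  ≈⟨ identityʳ _ ⟩
    (n % e) · x                        ∎)

-- Circuit values as sums of source terms

module Gates (𝔸 : FinAlgebra) where
  open FinAlgebra 𝔸

  weaken : ∀ {n s} → AGate 𝔸 n s → AGate 𝔸 n (suc s)
  weaken (input i) = input i
  weaken (const a) = const a
  weaken (gate f ins) = gate f (suc ∘ ins)

  -- Re-indexing every gate into the whole circuit gives one local equation per node, stated with
  -- the final values.
  gateAt : ∀ {n s} → ACirc 𝔸 n s → Fin s → AGate 𝔸 n s
  gateAt (g ∷ c) zero = weaken g
  gateAt (g ∷ c) (suc v) = weaken (gateAt c v)

  fanIn : ∀ {n s} → AGate 𝔸 n s → ℕ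
  fanIn (gate f _) = arity f
  fanIn _ = 0

  inputs : ∀ {n s} (g : AGate 𝔸 n s) → Fin (fanIn g) → Fin s
  inputs (gate f ins) = ins

  agateVal-weaken : ∀ {n s} (g' : AGate 𝔸 n s) (g : AGate 𝔸 n s) (c : ACirc 𝔸 n s) ρ →
    agateVal 𝔸 (weaken g) ρ (aVals 𝔸 (g' ∷ c) ρ) ≡ agateVal 𝔸 g ρ (aVals 𝔸 c ρ)
  agateVal-weaken g' (input i) c ρ = refl
  agateVal-weaken g' (const a) c ρ = refl
  agateVal-weaken g' (gate f ins) c ρ = refl

  aVals-gateAt : ∀ {n s} (c : ACirc 𝔸 n s) ρ v →
                 aVals 𝔸 c ρ v ≡ agateVal 𝔸 (gateAt c v) ρ (aVals 𝔸 c ρ)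
  aVals-gateAt (g ∷ c) ρ zero = sym (agateVal-weaken g g c ρ)
  aVals-gateAt (g ∷ c) ρ (suc v) =
    trans (aVals-gateAt c ρ v) (sym (agateVal-weaken g (gateAt c v) c ρ))

module Linearise (𝔸 : FinAlgebra) {u u' : Carrier 𝔸 → Carrier 𝔸} (E : Extension 𝔸 u u') where
  open FinAlgebra 𝔸
  open Gates 𝔸
  open Extension E
  open FiniteAbelianGroup isAbelianGroup
  open AbelianGroup G using (identityˡ; identityʳ; ∙-cong; ∙-congˡ; setoid; comm)
    renaming (refl to ≈-refl; sym to ≈-sym; trans to ≈-trans; reflexive to ≈-reflexive)

  source : ∀ {n s} → AGate 𝔸 n s → (Fin n → Carrier 𝔸) → (Fin s → Carrier 𝔸) → Carrier 𝔸
  source (input i) ρ v = ℓ (ρ i)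
  source (const a) ρ v = ℓ a
  source (gate f ins) ρ v = ℓ (op f (u ∘ v ∘ ins))

  through : ∀ {n s} → AGate 𝔸 n s → (Fin s → Carrier 𝔸) → Carrier 𝔸
  through (gate f ins) t = lin f (t ∘ ins)
  through _ t = ε

  -- transfer c v w y is the contribution of a source term y at node w to the
  -- linear coordinate of node v: the sum over all paths from w to v.
  transfer : ∀ {n s} → ACirc 𝔸 n s → Fin s → Fin s → Carrier 𝔸 → Carrier 𝔸
  transfer (g ∷ c) zero zero y = y
  transfer (g ∷ c) zero (suc w) y = through g (λ i → transfer c i w y)
  transfer (g ∷ c) (suc v) zero y = ε
  transfer (g ∷ c) (suc v) (suc w) y = transfer c v w y

  sourceAt : ∀ {n s} → ACirc 𝔸 n s → (Fin n → Carrier 𝔸) → Fin s → Carrier 𝔸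
  sourceAt c ρ w = source (gateAt c w) ρ (aVals 𝔸 c ρ)

  source-weaken : ∀ {n s} (g' g : AGate 𝔸 n s) (c : ACirc 𝔸 n s) ρ →
    source (weaken g) ρ (aVals 𝔸 (g' ∷ c) ρ) ≡ source g ρ (aVals 𝔸 c ρ)
  source-weaken g' (input i) c ρ = refl
  source-weaken g' (const a) c ρ = refl
  source-weaken g' (gate f ins) c ρ = refl

  lin-sum : ∀ f s (t : Fin (arity f) → Fin s → Carrier 𝔸) →
            lin f (λ i → sum (t i)) ≈ sum (λ w → lin f (λ i → t i w))
  lin-sum f zero t = lin-ε f
  lin-sum f (suc s) t = ≈-trans (lin-∙ f (λ i → t i zero) (λ i → sum (t i ∘ suc)))
    (∙-congˡ (lin-sum f s (λ i → t i ∘ suc)))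

  through-sum : ∀ {n k s} (g : AGate 𝔸 n k) (t : Fin k → Fin s → Carrier 𝔸) →
                through g (λ i → sum (t i)) ≈ sum (λ w → through g (λ i → t i w))
  through-sum {s = s} (input i) t = ≈-sym (sum-replicate-zero s)
  through-sum {s = s} (const a) t = ≈-sym (sum-replicate-zero s)
  through-sum {s = s} (gate f ins) t = lin-sum f s (t ∘ ins)

  ℓ-agateVal : ∀ {n s} (g : AGate 𝔸 n s) ρ v →
               ℓ (agateVal 𝔸 g ρ v) ≈ (source g ρ v ∙ through g (ℓ ∘ v))
  ℓ-agateVal (input i) ρ v = ≈-sym (identityʳ _)
  ℓ-agateVal (const a) ρ v = ≈-sym (identityʳ _)
  ℓ-agateVal (gate f ins) ρ v = ≈-trans (ℓ-op f (v ∘ ins)) (comm _ _)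

  through-cong : ∀ {n s} (g : AGate 𝔸 n s) {t t'} →
                 (∀ i → t i ≈ t' i) → through g t ≈ through g t'
  through-cong (input i) e = ≈-refl
  through-cong (const a) e = ≈-refl
  through-cong (gate f ins) e = lin-cong f (e ∘ ins)

  -- By `ℓ-agateVal` the coordinates satisfy an affine recursion along the circuit; additivity
  -- pushes each source term separately up to `v`. There may be exponentially many paths, but
  -- `transfer c v w` is still just one self-map of the carrier.
  ℓ-aVals : ∀ {n s} (c : ACirc 𝔸 n s) ρ v →
            ℓ (aVals 𝔸 c ρ v) ≈ sum (λ w → transfer c v w (sourceAt c ρ w))
  ℓ-aVals {s = suc s} (g ∷ c) ρ zero = ≈-trans (ℓ-agateVal g ρ (aVals 𝔸 c ρ)) (∙-cong
    (≈-reflexive (sym (source-weaken g g c ρ)))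
    (≈-trans (through-cong g (ℓ-aVals c ρ)) (≈-trans
      (through-sum g (λ i w → transfer c i w (sourceAt c ρ w)))
      (sum-cong-≋ (λ w → ≈-reflexive (cong (λ y → through g (λ i → transfer c i w y))
        (sym (source-weaken g (gateAt c w) c ρ))))))))
  ℓ-aVals (g ∷ c) ρ (suc v) = ≈-trans (ℓ-aVals c ρ v) (≈-trans
    (sum-cong-≋ (λ w → ≈-reflexive (cong (transfer c v w)
      (sym (source-weaken g (gateAt c w) c ρ)))))
    (≈-sym (identityˡ _)))

  ℓ-by-counts : ∀ e .{{_ : NonZero e}} → size ! ∣ e → ∀ {n s} (c : ACirc 𝔸 n s) ρ v →
    ℓ (aVals 𝔸 c ρ v) ≈ sum (λ x → toℕ (sumF s (λ w →
      if does (transfer c v w (sourceAt c ρ w) ≟ x) then 1 else 0) mod e) · x)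
  ℓ-by-counts e size!∣e {s = s} c ρ v = ≈-trans (ℓ-aVals c ρ v) (≈-trans
    (sum-by-value s _)
    (sum-cong-≋ (λ x → ≈-trans
      (≈-sym (%-· e size!∣e (sumF s (λ w →
        if does (transfer c v w (sourceAt c ρ w) ≟ x) then 1 else 0)) x))
      (≈-reflexive (cong (_· x) (sym (toℕ-mod _ e)))))))

-- Simulating one level of the series by three layers

module Simulation
  (𝔸 : FinAlgebra) (op-ext : OpExt 𝔸)
  (e m-1 : ℕ) {{e≢0 : NonZero e}} (2≤m : 2 ≤ suc m-1) (e∣m : e ∣ suc m-1)
  (size!∣e : FinAlgebra.size 𝔸 ! ∣ e) (size≤e : FinAlgebra.size 𝔸 ≤ e)
  (e^size≤m : e ^ suc (FinAlgebra.size 𝔸) ≤ suc m-1)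
  (size^arity≤m : ∀ f → FinAlgebra.size 𝔸 ^ suc (FinAlgebra.arity 𝔸 f) ≤ suc m-1)
  {{size≢0 : NonZero (FinAlgebra.size 𝔸)}}
  (ι : Bool → Carrier 𝔸) where

  open FinAlgebra 𝔸
  open Gates 𝔸

  m : ℕ
  m = suc m-1

  A : Set
  A = Carrier 𝔸

  restrict : (A → A) → ∀ {n s} → AGate 𝔸 n s → A → A
  restrict u (gate f ins) a = u a
  restrict u _ a = a

  -- Sources carry their exact value, gates only their value modulo the kernel of u.
  state : (A → A) → ∀ {n s} → ACirc 𝔸 n s → (Fin n → Bool) → Fin s → A
  state u c w v = restrict u (gateAt c v) (aVals 𝔸 c (ι ∘ w) v)

  -- `K` and `D` are fixed before the circuit: size stays linear in `n` and `s`, depth stays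
  -- constant.
  Simulated : (A → A) → ℕ → ℕ → Set
  Simulated u K D = ∀ {n s} (c : ACirc 𝔸 n s) →
    Layers.Signals m-1 n s size (state u c) (n + s * K) D

  module Step {u u' : A → A} (E : Extension 𝔸 u u') (u-idem : ∀ a → u (u a) ≡ u a) where
    open Extension E
    open Linearise 𝔸 E
    open FiniteAbelianGroup isAbelianGroup
    open AbelianGroup G using () renaming (sym to ≈-sym; reflexive to ≈-reflexive)

    u-restrict : ∀ {n s} (g : AGate 𝔸 n s) a → u (restrict u g a) ≡ u a
    u-restrict (input i) a = refl
    u-restrict (const b) a = refl
    u-restrict (gate f ins) a = u-idem a

    -- Position zero is the node itself, from which inputs and constants take their exact value;
    -- gates use the remaining positions.
    localSource : ∀ {n s} (g : AGate 𝔸 n s) → (Fin (suc (fanIn g)) → A) → A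
    localSource (gate f ins) x = ℓ (op f (u ∘ x ∘ suc))
    localSource _ x = ℓ (x zero)

    localSource-ext : ∀ {n s} (g : AGate 𝔸 n s) {x y} → x ≗ y → localSource g x ≡ localSource g y
    localSource-ext (input i) x≗y = cong ℓ (x≗y zero)
    localSource-ext (const a) x≗y = cong ℓ (x≗y zero)
    localSource-ext (gate f ins) x≗y = cong ℓ (op-ext f (λ i → cong u (x≗y (suc i))))

    localSource-correct : ∀ {n s} (g : AGate 𝔸 n s) ρ v a (x : Fin s → A) →
      a ≡ agateVal 𝔸 g ρ v → (∀ i → u (x i) ≡ u (v i)) →
      localSource g (restrict u g a Vector.∷ x ∘ inputs g) ≡ source g ρ v
    localSource-correct (input i) ρ v a x a≡ ux≡ = cong ℓ a≡
    localSource-correct (const b) ρ v a x a≡ ux≡ = cong ℓ a≡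
    localSource-correct (gate f ins) ρ v a x a≡ ux≡ = cong ℓ (op-ext f (ux≡ ∘ ins))

    toA : Fin e → A
    toA z = toℕ z mod size

    -- Position zero holds the old state, the other positions the number of summands, modulo `e`,
    -- equal to each element.
    rebuild : ∀ {n s} (g : AGate 𝔸 n s) → (Fin (suc size) → Fin e) → A
    rebuild (gate f ins) y = assemble (sum (λ x → toℕ (y (suc x)) · x)) (u (toA (y zero)))
    rebuild _ y = toA (y zero)

    rebuild-ext : ∀ {n s} (g : AGate 𝔸 n s) {x y} → x ≗ y → rebuild g x ≡ rebuild g y
    rebuild-ext (input i) x≗y = cong toA (x≗y zero)
    rebuild-ext (const a) x≗y = cong toA (x≗y zero)
    rebuild-ext (gate f ins) {x} {y} x≗y = trans
      (assemble-cong _ (sum-cong-≋ (λ i → ≈-reflexive (cong (λ k → toℕ k · i) (x≗y (suc i))))))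
      (cong (λ k → assemble (sum (λ i → toℕ (y (suc i)) · i)) (u (toA k))) (x≗y zero))

    rebuild-correct : ∀ {n s} (g : AGate 𝔸 n s) a y → toA (y zero) ≡ restrict u g a →
      ℓ a ≈ sum (λ x → toℕ (y (suc x)) · x) → rebuild g y ≡ restrict u' g a
    rebuild-correct (input i) a y y₀≡ ℓa≈ = y₀≡
    rebuild-correct (const b) a y y₀≡ ℓa≈ = y₀≡
    rebuild-correct (gate f ins) a y y₀≡ ℓa≈ = trans
      (cong (assemble _) (trans (cong u y₀≡) (u-idem a)))
      (trans (assemble-cong (u a) (≈-sym ℓa≈)) (assemble-ℓ a))

    toA-mod : ∀ (a : A) → toA (toℕ a mod e) ≡ a
    toA-mod a = trans
      (cong (_mod size) (trans (toℕ-mod (toℕ a) e) (m<n⇒m%n≡m (<-≤-trans (toℕ<n a) size≤e))))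
      (toℕ-mod-id a)

    K' : ℕ → ℕ
    K' K = size * m + (suc size * (e * m) + (size * size * m + K))

    module _ {K D n s} (c : ACirc 𝔸 n s)
      (sig : Layers.Signals m-1 n s size (state u c) (n + s * K) D) where
      open Layers m-1 n hiding (m)

      -- A layer sees only the one before it, so the state, which `rebuild` needs again, travels
      -- along with the source term.
      paired : Input → Fin s → Fin (size * size)
      paired w v = combine (sourceAt c (ι ∘ w) v) (state u c w v)

      layer₁ : Signals s (size * size) paired (s * (size * size * m) + (n + s * K)) (suc D)
      layer₁ = Signals-resp
        (λ w v → cong (λ a → combine a (state u c w v)) (trans
          (localSource-ext (gateAt c v) λ { zero → refl ; (suc i) → refl })
          (localSource-correct (gateAt c v) (ι ∘ w) (aVals 𝔸 c (ι ∘ w)) _ (state u c w)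
            (aVals-gateAt c (ι ∘ w) v) (λ i → u-restrict (gateAt c i) _))))
        (localSignals sig s (size * size) (λ v → suc (fanIn (gateAt c v)))
          (λ v → fits (gateAt c v)) (λ v → v Vector.∷ inputs (gateAt c v))
          (λ v x → combine (localSource (gateAt c v) x) (x zero))
          (λ v x≗y → cong₂ combine (localSource-ext (gateAt c v) x≗y) (x≗y zero)))
        where
        size^1≤m : size ^ 1 ≤ m
        size^1≤m = ≤-trans (^-monoˡ-≤ 1 size≤e)
          (≤-trans (^-monoʳ-≤ e {1} {suc size} (s≤s z≤n)) e^size≤m)
        fits : (g : AGate 𝔸 n s) → size ^ suc (fanIn g) ≤ m
        fits (gate f ins) = size^arity≤m f
        fits (input i) = size^1≤m
        fits (const a) = size^1≤m

      -- Index zero passes the state of `v` on as a sum with at most one nonzero term; it survives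
      -- reduction modulo `e` because `size ≤ e`.
      weight : Fin s × Fin (suc size) → Fin s → Fin (size * size) → ℕ
      weight (v , zero) w z =
        if does (v ≟ w) then toℕ (proj₂ (remQuot {size} size z)) else 0
      weight (v , suc x) w z =
        if does (transfer c v w (proj₁ (remQuot {size} size z)) ≟ x) then 1 else 0

      counts : Input → Fin (s * suc size) → Fin e
      counts w j = sumF s (λ v → weight (remQuot (suc size) j) v (paired w v)) mod e

      layer₂ : Signals (s * suc size) e counts
        (s * suc size * (e * m) + (s * (size * size * m) + (n + s * K))) (suc (suc D))
      layer₂ = countSignals layer₁ (s * suc size) e e∣m
        (λ j → weight (remQuot (suc size) j))

      counts-zero : ∀ w v → counts w (combine v zero) ≡ toℕ (state u c w v) mod e
      counts-zero w v = cong (_mod e) (trans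
        (sumF-cong s λ v' → cong (λ p → weight p v' (paired w v')) (remQuot-combine v zero))
        (trans
          (sumF-cong s λ v' → cong (λ r → if does (v ≟ v') then toℕ (proj₂ r) else 0)
            (remQuot-combine {size} {size} (sourceAt c (ι ∘ w) v') (state u c w v')))
          (sumF-δ v (λ v' → toℕ (state u c w v')))))

      counts-suc : ∀ w v x → counts w (combine v (suc x)) ≡ sumF s (λ v' →
        if does (transfer c v v' (sourceAt c (ι ∘ w) v') ≟ x) then 1 else 0) mod e
      counts-suc w v x = cong (_mod e) (sumF-cong s λ v' → trans
        (cong (λ p → weight p v' (paired w v')) (remQuot-combine v (suc x)))
        (cong (λ r → if does (transfer c v v' (proj₁ r) ≟ x) then 1 else 0)
          (remQuot-combine {size} {size} (sourceAt c (ι ∘ w) v') (state u c w v'))))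

      layer₃ : Signals s size (state u' c)
        (s * (size * m) +
          (s * suc size * (e * m) + (s * (size * size * m) + (n + s * K)))) (3 + D)
      layer₃ = Signals-resp
        (λ w v → rebuild-correct (gateAt c v) (aVals 𝔸 c (ι ∘ w) v) (counts w ∘ combine v)
          (trans (cong toA (counts-zero w v)) (toA-mod _))
          (AbelianGroup.trans G (ℓ-by-counts e size!∣e c (ι ∘ w) v)
            (sum-cong-≋ (λ x → ≈-reflexive
              (cong (λ k → toℕ k · x) (sym (counts-suc w v x)))))))
        (localSignals layer₂ s size (λ _ → suc size)
          (λ _ → e^size≤m) (λ v → combine v) (λ v → rebuild (gateAt c v))
          (λ v → rebuild-ext (gateAt c v)))

      step : Signals s size (state u' c) (n + s * K' K) (3 + D)
      step = subst (λ Z → Signals s size (state u' c) Z (3 + D))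
        (total-size s n K (size * m) (suc size) (e * m) (size * size * m)) layer₃
        where
        total-size : ∀ s n K a b b' c →
          s * a + (s * b * b' + (s * c + (n + s * K))) ≡ n + s * (a + (b * b' + (c + K)))
        total-size = solve-∀

    simulate-step : ∀ {K D} → Simulated u K D → Simulated u' (K' K) (3 + D)
    simulate-step sim c = step c (sim c)

  bit-mod : ∀ b → (toℕ ((if b then 1 else 0) mod m) ≡ᵇ 1) ≡ b
  bit-mod true = cong (_≡ᵇ 1) (trans (toℕ-mod 1 m) (m<n⇒m%n≡m 2≤m))
  bit-mod false = refl

  -- Modulo the total congruence gates carry no information, so every node depends on at most one
  -- input bit.
  simulate-base : ∀ {u : A → A} {a₀} → (∀ a → u a ≡ a₀) → Simulated u (size * m) 1
  simulate-base {u} {a₀} u≡a₀ {n} {s} c = subst (λ Z → Signals s size (state u c) Z 1)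
    (+-comm (s * (size * m)) n)
    (Signals-resp (λ w v → correct w (gateAt c v) (aVals-gateAt c (ι ∘ w) v))
      (inputSignals s size (reads ∘ gateAt c) (λ v → result (gateAt c v))))
    where
    open Layers m-1 n hiding (m)
    reads : AGate 𝔸 n s → Fin n → Bool
    reads (input i) j = does (i ≟ j)
    reads _ j = false
    result : AGate 𝔸 n s → Fin m → A
    result (input i) r = ι (toℕ r ≡ᵇ 1)
    result (const a) r = a
    result (gate f ins) r = a₀
    correct : ∀ w g {a} → a ≡ agateVal 𝔸 g (ι ∘ w) (aVals 𝔸 c (ι ∘ w)) →
              result g (count n (reads g) w mod m) ≡ restrict u g a
    correct w (const a) a≡ = sym a≡
    correct w (gate f ins) a≡ = sym (u≡a₀ _)
    correct w (input i) a≡ = trans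
      (cong ι (trans
        (cong (λ k → toℕ (k mod m) ≡ᵇ 1)
          (trans (sumF-cong n λ j → if-∧ (does (i ≟ j)) (w j))
            (sumF-δ i (λ j → if w j then 1 else 0))))
        (bit-mod (w i))))
      (sym a≡)
      where
      if-∧ : ∀ b b' → (if b ∧ b' then 1 else 0) ≡ (if b then (if b' then 1 else 0) else 0)
      if-∧ true b' = refl
      if-∧ false b' = refl

  module _ {u : A → A} (u-id : ∀ a → u a ≡ a)
    {K D : ℕ} (sim : Simulated u K D) (S : A → Bool) where

    output : ∀ {n s} (c : ACirc 𝔸 n (suc s)) →
      Layers.Bits m-1 n 1 (λ w _ → S (aOut 𝔸 c (ι ∘ w))) (1 + (n + suc s * K)) (suc D)
    output {n} {s} c = Bits-resp (λ w _ → correct w)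
      (weightedBits (sim c) 1
        (λ _ v a → if does (zero ≟ v) then (if S a then 1 else 0) else 0)
        (λ _ r → toℕ r ≡ᵇ 1))
      where
      open Layers m-1 n hiding (m)
      restrict-id : ∀ (g : AGate 𝔸 n (suc s)) a → restrict u g a ≡ a
      restrict-id (input i) a = refl
      restrict-id (const b) a = refl
      restrict-id (gate f ins) a = u-id a
      correct : ∀ w → (toℕ (sumF (suc s) (λ v → if does (zero ≟ v)
        then (if S (state u c w v) then 1 else 0) else 0) mod m) ≡ᵇ 1) ≡ S (aOut 𝔸 c (ι ∘ w))
      correct w = trans
        (cong (λ k → toℕ (k mod m) ≡ᵇ 1)
          (sumF-δ {suc s} zero (λ v → if S (state u c w v) then 1 else 0)))
        (trans (bit-mod _) (cong S (restrict-id (gateAt c zero) _)))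

-- Polynomial bounds and descent through all levels

≤-maxF : ∀ {s} (f : Fin s → ℕ) i → f i ≤ maxF s f
≤-maxF {suc s} f zero = m≤m⊔n (f zero) _
≤-maxF {suc s} f (suc i) = ≤-trans (≤-maxF (f ∘ suc) i) (m≤n⊔m (f zero) _)

-- The `+ 1` covers `n = 0`, where `0 ^ 0` is `1` but `0 ^ b` may be `0`.
^-mono-exponent : ∀ n {a b} → a ≤ b → n ^ a ≤ n ^ b + 1
^-mono-exponent zero {zero} {b} a≤b = m≤n+m 1 (0 ^ b)
^-mono-exponent zero {suc a} a≤b = z≤n
^-mono-exponent (suc n) {a} {b} a≤b = ≤-trans (^-monoʳ-≤ (suc n) a≤b) (m≤m+n (suc n ^ b) 1)

PolyBounded-linear : ∀ c K {sz : ℕ → ℕ} → PolyBounded c sz →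
  PolyBounded (2 + c + 2 * c * K) (λ n → 1 + (n + sz n * K))
PolyBounded-linear c K {sz} sz≤ n = begin
  1 + (n + sz n * K)
    ≤⟨ +-monoʳ-≤ 1 (+-mono-≤
         (subst (_≤ n ^ C + 1) (*-identityʳ n) (^-mono-exponent n {1} {C} (s≤s z≤n)))
         (*-monoˡ-≤ K (≤-trans (sz≤ n)
           (+-monoˡ-≤ c (*-monoʳ-≤ c (^-mono-exponent n {c} {C} c≤C)))))) ⟩
  1 + (n ^ C + 1 + (c * (n ^ C + 1) + c) * K)
    ≤⟨ m≤m+n _ ((1 + c + c * K) * n ^ C + c) ⟩
  1 + (n ^ C + 1 + (c * (n ^ C + 1) + c) * K) + ((1 + c + c * K) * n ^ C + c)
    ≡⟨ expand c K (n ^ C) ⟩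
  C * n ^ C + C ∎
  where
  open ≤-Reasoning
  -- The bound has coefficient `1 + c * K` and constant `2 + 2 * c * K`; `C` exceeds both and,
  -- serving also as exponent, is at least `c`.
  C = 2 + c + 2 * c * K
  c≤C : c ≤ C
  c≤C = ≤-trans (m≤n+m c 2) (m≤m+n (2 + c) (2 * c * K))
  expand : ∀ c K P → 1 + (P + 1 + (c * (P + 1) + c) * K) + ((1 + c + c * K) * P + c) ≡
                     (2 + c + 2 * c * K) * P + (2 + c + 2 * c * K)
  expand = solve-∀

mainTheorem8 : (𝔸 : FinAlgebra) → IsMalcev 𝔸 → IsNilpotent 𝔸 →
    (L : Lang) → nuP 𝔸 L → CC0 L
mainTheorem8 𝔸 malcev nilpotent L (c , t , ι , S , t-bounded , t-correct) =
  suc (pred m) , 2≤m , suc D , 2 + c + 2 * c * K ,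
  (λ n → Layers.Bits.rest (bits n) , Layers.Bits.circ (bits n)) ,
  (λ n → ≤-trans (Layers.Bits.size≤ (bits n)) (PolyBounded-linear c K t-bounded n)) ,
  (λ n → Layers.Bits.depth≤ (bits n) zero) ,
  (λ n w → trans (Layers.Bits.correct (bits n) w zero) (t-correct n w))
  where
  open FinAlgebra 𝔸

  op-ext : OpExt 𝔸
  op-ext = nilpotent⇒opExt 𝔸 nilpotent

  instance
    size≢0 : NonZero size
    size≢0 = nonZeroIndex (ι true)

  -- Any element can serve as the base point `𝟎`; `ι` supplies one.
  open Malcev 𝔸 op-ext malcev (ι true)
    using (rep; rep-unique; rep-related; level; level-cong; meet-good; level⊆lowerCentral)

  -- Moduli: e is a multiple of the exponents of all the abelian groups involved,
  -- and m is a multiple of e exceeding all the numbers that have to be read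
  -- from a sum.
  e E m : ℕ
  e = size ! * (2 + size)
  E = suc size + maxF nOps arity
  m = e ^ E

  instance
    e≢0 : NonZero e
    e≢0 = m*n≢0 (size !) (2 + size) {{size !≢0}}

  -- This is the purpose of the second factor of `e`: `size !` alone may be `1`, or smaller than
  -- `size`.
  2+size≤e : 2 + size ≤ e
  2+size≤e = m≤n*m (2 + size) (size !) {{size !≢0}}

  size≤e : size ≤ e
  size≤e = ≤-trans (m≤n+m size 2) 2+size≤e

  m-suc : suc (pred m) ≡ m
  m-suc = suc-pred m {{m^n≢0 e E}}

  ≤m : ∀ {k} → k ≤ m → k ≤ suc (pred m)
  ≤m {k} = subst (k ≤_) (sym m-suc)

  2≤m : 2 ≤ suc (pred m)
  2≤m = ≤m (≤-trans (m≤m+n 2 size) (≤-trans 2+size≤e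
    (subst (_≤ m) (*-identityʳ e) (^-monoʳ-≤ e {1} {E} (s≤s z≤n)))))

  open Simulation 𝔸 op-ext e (pred m) 2≤m
    (∣-trans (m∣m*n (e ^ (size + maxF nOps arity))) (∣-reflexive (sym m-suc)))
    (m∣m*n (2 + size)) size≤e
    (≤m (^-monoʳ-≤ e (m≤m+n (suc size) (maxF nOps arity))))
    (λ f → ≤m (≤-trans (^-monoˡ-≤ (suc (arity f)) size≤e)
      (^-monoʳ-≤ e (s≤s (≤-trans (≤-maxF arity f) (m≤n+m (maxF nOps arity) size))))))
    ι using (Simulated; simulate-base; output; module Step)

  simulate-level : ∀ i → Σ ℕ λ K → Σ ℕ λ D → Simulated (rep (level i)) K D
  simulate-level zero = _ , _ , simulate-base (λ a → rep-unique (level-cong 0) {a} {ι true} refl)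
  simulate-level (suc i) with K , D , sim ← simulate-level i =
    _ , _ , Step.simulate-step
      (good⇒extension 𝔸 op-ext malcev (ι true) (level-cong i) (meet-good (level i)))
      (λ a → sym (rep-unique (level-cong i) (rep-related (level-cong i) a)))
      sim

  class : ℕ
  class = proj₁ nilpotent

  K D : ℕ
  K = proj₁ (simulate-level class)
  D = proj₁ (proj₂ (simulate-level class))

  -- Nilpotency makes the last classes singletons, so the simulated states are the exact values.
  rep-id : ∀ a → rep (level class) a ≡ a
  rep-id a = sym (proj₂ nilpotent _ _
    (level⊆lowerCentral class (rep-related (level-cong class) a)))

  bits : ∀ n → _
  bits n = output rep-id (proj₂ (proj₂ (simulate-level class))) S (proj₂ (t n))
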